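{- The derivability problems for each of the multiplicative fragments $\mathcal{M}'^{\,\mathrm{mult}}_{2015}$, $\mathcal{M}'^{\,\mathrm{mult}}_{2018}$ and $\mathcal{M}'^{ -,\mathrm{mult}}_{2018}$ of the calculi with stoups defined below are algorithmically undecidable.
   Context: Formulae are built from a countable set of variables and the constant $\mathbf{1}$ by the binary connectives $\backslash$, $/$, $\cdot$, $\wedge$, $\vee$ and the unary connectives $\langle\rangle$, $[]^{ -1}$ and $!$. A stoup is a finite multiset of formulae ($\varnothing$ empty). A tree term is a formula or $[\Xi]$ with $\Xi$ a meta-formula; a meta-formula is $\zeta;\Gamma$ with $\zeta$ a stoup and $\Gamma$ a finite linearly ordered sequence of tree terms (empty sequence $\Lambda$); $\varnothing;\Gamma$ is written $\Gamma$. Comma denotes concatenation of sequences and multiset union of stoups; $\zeta,A$ adds a copy of $A$. A sequent is $\Xi\to C$. $\Xi(\Theta)$ denotes a meta-formula with a designated occurrence of a meta-formula $\Theta$ which is $\Xi$ itself or the content of some bracket $[\Theta]$ at any depth; $\Xi(\Theta')$ is the result of replacement. Common axioms and rules: $A\to A$, $\Lambda\to\mathbf1$; ($/L$) from $\zeta_1;\Gamma\to B$ and $\Xi(\zeta_2;\Delta_1,C,\Delta_2)\to D$ infer $\Xi(\zeta_1,\zeta_2;\Delta_1,C/B,\Gamma,\Delta_2)\to D$; ($/R$) from $\zeta;\Gamma,B\to C$ infer $\zeta;\Gamma\to C/B$; ($\backslash L$) from $\zeta_1;\Gamma\to A$ and $\Xi(\zeta_2;\Delta_1,C,\Delta_2)\to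 D$ infer $\Xi(\zeta_1,\zeta_2;\Delta_1,\Gamma,A\backslash C,\Delta_2)\to D$; ($\backslash R$) from $\zeta;A,\Gamma\to C$ infer $\zeta;\Gamma\to A\backslash C$; ($\cdot L$) from $\Xi(\zeta;\Delta_1,A,B,\Delta_2)\to D$ infer $\Xi(\zeta;\Delta_1,A\cdot B,\Delta_2)\to D$; ($\cdot R$) from $\zeta_1;\Delta\to A$ and $\zeta_2;\Gamma\to B$ infer $\zeta_1,\zeta_2;\Delta,\Gamma\to A\cdot B$; ($\mathbf1L$) from $\Xi(\zeta;\Delta_1,\Delta_2)\to A$ infer $\Xi(\zeta;\Delta_1,\mathbf1,\Delta_2)\to A$; ($\vee L$), ($\vee R_i$), ($\wedge L_i$), ($\wedge R$) as usual with the context $\Xi(\zeta;\Delta_1,\cdot,\Delta_2)$ for left rules (from $\Xi(\zeta;\Delta_1,A_1,\Delta_2)\to C$ and $\Xi(\zeta;\Delta_1,A_2,\Delta_2)\to C$ infer $\Xi(\zeta;\Delta_1,A_1\vee A_2,\Delta_2)\to C$; from $\Xi\to A_i$ infer $\Xi\to A_1\vee A_2$; from $\Xi(\zeta;\Delta_1,A_i,\Delta_2)\to C$ infer $\Xi(\zeta;\Delta_1,A_1\wedge A_2,\Delta_2)\to C$; from $\Xi\to A_1$ and $\Xi\to A_2$ infer $\Xi\to A_1\wedge A_2$); ($[]^{ -1}L$) from $\Xi(\zeta;\Delta_1,A,\Delta_2)\to B$ infer $\Xi(\zeta;\Delta_1,[[]^{ -1}A],\Delta_2)\to B$; ($[]^{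 -1}R$) from $[\Xi]\to A$ infer $\Xi\to[]^{ -1}A$; ($\langle\rangle L$) from $\Xi(\zeta;\Delta_1,[A],\Delta_2)\to B$ infer $\Xi(\zeta;\Delta_1,\langle\rangle A,\Delta_2)\to B$; ($\langle\rangle R$) from $\Xi\to A$ infer $[\Xi]\to\langle\rangle A$; ($!L$) from $\Xi(\zeta,A;\Gamma_1,\Gamma_2)\to B$ infer $\Xi(\zeta;\Gamma_1,!A,\Gamma_2)\to B$; ($!P$) from $\Xi(\zeta;\Gamma_1,A,\Gamma_2)\to B$ infer $\Xi(\zeta,A;\Gamma_1,\Gamma_2)\to B$. $\mathcal{M}'_{2015}$: common rules plus ($!R'$) from $\zeta;\Lambda\to B$ infer $\zeta;\Lambda\to!B$ if $\zeta\ne\varnothing$, and ($!C'$) from $\Xi(\zeta_1,\zeta_2;\Gamma_1,[\zeta',\zeta_2;\Gamma_2],\Gamma_3)\to C$ infer $\Xi(\zeta_1,\zeta_2,\zeta';\Gamma_1,\Gamma_2,\Gamma_3)\to C$ if $\zeta_2\neq\varnothing$. $\mathcal{M}'_{2018}$: common rules plus ($!R'$) from $A;\Lambda\to B$ infer $A;\Lambda\to!B$, and ($!C'$) from $\Xi(\zeta,A;\Gamma_1,[\zeta',A;\Gamma_2],\Gamma_3)\to B$ infer $\Xi(\zeta,A;\Gamma_1,[[\zeta';\Gamma_2]],\Gamma_3)\to B$. $\mathcal{M}'^{ - }_{2018}$: $\mathcal{M}'_{2018}$ restricted to formulae without $\mathbf1$, without $\Lambda\to\mathbf1$ and $\mathbf1L$,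 with $\backslash R,/R$ allowed only if $\Gamma\ne\Lambda$ or $\zeta\neq\varnothing$, and $!C'$ only if $\Gamma_2\ne\Lambda$ or $\zeta'\ne\varnothing$. Cut is not a rule. The multiplicative fragment (superscript $\mathrm{mult}$) uses only formulae without $\wedge,\vee$ and omits their rules. -}

module Defs where

open import Data.Bool.Base using (Bool; true; false)
open import Data.Fin.Base using (Fin)
open import Data.List.Base using (List; []; _∷_; _++_; replicate; map)
open import Data.List.Properties using (++-assoc; ++-identityʳ; ∷-injectiveˡ; ∷-injectiveʳ)
open import Data.List.Relation.Binary.Permutation.Propositional using (_↭_)
open import Data.Maybe.Base using (Maybe; just; nothing; _>>=_)
open import Data.Maybe.Properties using (just-injective)
open import Data.Nat.Base using (ℕ; zero; suc)
open import Data.Product.Base using (_×_; ∃-syntax)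
open import Data.Sum.Base using (_⊎_; inj₁)
open import Data.Unit.Base using (⊤)
open import Function.Bundles using (_↣_; mk↣; module Injection)
open import Relation.Binary.PropositionalEquality
  using (_≡_; _≢_; refl; sym; trans; cong)
open import Relation.Nullary.Negation.Core using (¬_)

------------------------------------------------------------------------
-- Formulae and sequents

-- A language is fixed by whether it has the constant 𝟏 and whether it has
-- the additive connectives ∧ and ∨.

data Units : Set where
  unital unit-free : Units

data Additives : Set where
  additive multiplicative : Additives

infix  9 ⟨⟩_ []⁻¹_ !_
infixr 8 _·_
infixr 7 _╲_
infixl 7 _╱_
infixr 6 _∧_ _∨_

data Formula : Units → Additives → Set where
  var    : ∀ {u a} → ℕ → Formula u a
  𝟏      : ∀ {a} → Formula unital a
  _╲_    : ∀ {u a} → Formula u a → Formula u a → Formula u a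
  _╱_    : ∀ {u a} → Formula u a → Formula u a → Formula u a
  _·_    : ∀ {u a} → Formula u a → Formula u a → Formula u a
  _∧_    : ∀ {u} → Formula u additive → Formula u additive → Formula u additive
  _∨_    : ∀ {u} → Formula u additive → Formula u additive → Formula u additive
  ⟨⟩_    : ∀ {u a} → Formula u a → Formula u a
  []⁻¹_  : ∀ {u a} → Formula u a → Formula u a
  !_     : ∀ {u a} → Formula u a → Formula u a

-- A stoup is a multiset, represented by a list; the rule `exchange` below
-- makes derivability independent of the order of the list.

Stoup : Units → Additives → Set
Stoup u a = List (Formula u a)

infix 4 _⨾_

mutual
  data TreeTerm (u : Units) (a : Additives) : Set where
    fm  : Formula u a → TreeTerm u a
    [_] : MetaFormula u a → TreeTerm u a

  data MetaFormula (u : Units) (a : Additives) : Set where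
    _⨾_ : Stoup u a → List (TreeTerm u a) → MetaFormula u a

-- Meta-formulae Ξ(_) with a designated occurrence of a meta-formula: the
-- whole, or the content of a bracket at any depth.

data Context (u : Units) (a : Additives) : Set where
  □      : Context u a
  within : Stoup u a → List (TreeTerm u a) → Context u a → List (TreeTerm u a) →
           Context u a

infix 6 _⟦_⟧

_⟦_⟧ : ∀ {u a} → Context u a → MetaFormula u a → MetaFormula u a
□                ⟦ Θ ⟧ = Θ
within ζ Γ₁ Ξ Γ₂ ⟦ Θ ⟧ = ζ ⨾ (Γ₁ ++ [ Ξ ⟦ Θ ⟧ ] ∷ Γ₂)

infix 3 _⇒_

data Sequent (u : Units) (a : Additives) : Set where
  _⇒_ : MetaFormula u a → Formula u a → Sequent u a

------------------------------------------------------------------------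
-- The calculi

-- Indexing by `Units` confines M′₂₀₁₈⁻ to formulae without 𝟏, which also
-- removes both rules for 𝟏.  In the same way the multiplicative fragment
-- of each calculus is obtained by taking the sequents over the language
-- `multiplicative`, to which no rule for ∧ or ∨ applies.

data Calculus : Units → Set where
  M′₂₀₁₅  : Calculus unital
  M′₂₀₁₈  : Calculus unital
  M′₂₀₁₈⁻ : Calculus unit-free

data Is2018 : ∀ {u} → Calculus u → Set where
  full       : Is2018 M′₂₀₁₈
  restricted : Is2018 M′₂₀₁₈⁻

-- The side condition that M′₂₀₁₈⁻ puts on ╲R, ╱R and !C′.

Admissible : ∀ {u a} → Calculus u → Stoup u a → List (TreeTerm u a) → Set
Admissible M′₂₀₁₅  ζ Γ = ⊤
Admissible M′₂₀₁₈  ζ Γ = ⊤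
Admissible M′₂₀₁₈⁻ ζ Γ = Γ ≢ [] ⊎ ζ ≢ []

infix 2 _⊢_

data _⊢_ : ∀ {u a} → Calculus u → Sequent u a → Set where

  exchange : ∀ {u a} {S : Calculus u} (Ξ : Context u a) {ζ ζ′ Γ C} →
             ζ ↭ ζ′ →
             S ⊢ Ξ ⟦ ζ ⨾ Γ ⟧ ⇒ C →
             S ⊢ Ξ ⟦ ζ′ ⨾ Γ ⟧ ⇒ C

  ax : ∀ {u a} {S : Calculus u} {A : Formula u a} →
       S ⊢ [] ⨾ fm A ∷ [] ⇒ A

  ╱L : ∀ {u a} {S : Calculus u} (Ξ : Context u a) {ζ₁ ζ₂ Γ Δ₁ Δ₂ B C D} →
       S ⊢ ζ₁ ⨾ Γ ⇒ B →
       S ⊢ Ξ ⟦ ζ₂ ⨾ Δ₁ ++ fm C ∷ Δ₂ ⟧ ⇒ D →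
       S ⊢ Ξ ⟦ ζ₁ ++ ζ₂ ⨾ Δ₁ ++ fm (C ╱ B) ∷ Γ ++ Δ₂ ⟧ ⇒ D

  ╱R : ∀ {u a} {S : Calculus u} {ζ : Stoup u a} {Γ B C} →
       Admissible S ζ Γ →
       S ⊢ ζ ⨾ Γ ++ fm B ∷ [] ⇒ C →
       S ⊢ ζ ⨾ Γ ⇒ C ╱ B

  ╲L : ∀ {u a} {S : Calculus u} (Ξ : Context u a) {ζ₁ ζ₂ Γ Δ₁ Δ₂ A C D} →
       S ⊢ ζ₁ ⨾ Γ ⇒ A →
       S ⊢ Ξ ⟦ ζ₂ ⨾ Δ₁ ++ fm C ∷ Δ₂ ⟧ ⇒ D →
       S ⊢ Ξ ⟦ ζ₁ ++ ζ₂ ⨾ Δ₁ ++ Γ ++ fm (A ╲ C) ∷ Δ₂ ⟧ ⇒ D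

  ╲R : ∀ {u a} {S : Calculus u} {ζ : Stoup u a} {Γ A C} →
       Admissible S ζ Γ →
       S ⊢ ζ ⨾ fm A ∷ Γ ⇒ C →
       S ⊢ ζ ⨾ Γ ⇒ A ╲ C

  ·L : ∀ {u a} {S : Calculus u} (Ξ : Context u a) {ζ Δ₁ Δ₂ A B D} →
       S ⊢ Ξ ⟦ ζ ⨾ Δ₁ ++ fm A ∷ fm B ∷ Δ₂ ⟧ ⇒ D →
       S ⊢ Ξ ⟦ ζ ⨾ Δ₁ ++ fm (A · B) ∷ Δ₂ ⟧ ⇒ D

  ·R : ∀ {u a} {S : Calculus u} {ζ₁ ζ₂ : Stoup u a} {Δ Γ A B} →
       S ⊢ ζ₁ ⨾ Δ ⇒ A →
       S ⊢ ζ₂ ⨾ Γ ⇒ B →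
       S ⊢ ζ₁ ++ ζ₂ ⨾ Δ ++ Γ ⇒ A · B

  𝟏L : ∀ {a} {S : Calculus unital} (Ξ : Context unital a) {ζ Δ₁ Δ₂ A} →
       S ⊢ Ξ ⟦ ζ ⨾ Δ₁ ++ Δ₂ ⟧ ⇒ A →
       S ⊢ Ξ ⟦ ζ ⨾ Δ₁ ++ fm 𝟏 ∷ Δ₂ ⟧ ⇒ A

  𝟏R : ∀ {a} {S : Calculus unital} →
       S ⊢ [] ⨾ [] ⇒ 𝟏 {a}

  ∨L : ∀ {u} {S : Calculus u} (Ξ : Context u additive) {ζ Δ₁ Δ₂ A₁ A₂ C} →
       S ⊢ Ξ ⟦ ζ ⨾ Δ₁ ++ fm A₁ ∷ Δ₂ ⟧ ⇒ C →
       S ⊢ Ξ ⟦ ζ ⨾ Δ₁ ++ fm A₂ ∷ Δ₂ ⟧ ⇒ C →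
       S ⊢ Ξ ⟦ ζ ⨾ Δ₁ ++ fm (A₁ ∨ A₂) ∷ Δ₂ ⟧ ⇒ C

  ∨R₁ : ∀ {u} {S : Calculus u} {Ξ : MetaFormula u additive} {A₁ A₂} →
        S ⊢ Ξ ⇒ A₁ →
        S ⊢ Ξ ⇒ A₁ ∨ A₂

  ∨R₂ : ∀ {u} {S : Calculus u} {Ξ : MetaFormula u additive} {A₁ A₂} →
        S ⊢ Ξ ⇒ A₂ →
        S ⊢ Ξ ⇒ A₁ ∨ A₂

  ∧L₁ : ∀ {u} {S : Calculus u} (Ξ : Context u additive) {ζ Δ₁ Δ₂ A₁ A₂ C} →
        S ⊢ Ξ ⟦ ζ ⨾ Δ₁ ++ fm A₁ ∷ Δ₂ ⟧ ⇒ C →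
        S ⊢ Ξ ⟦ ζ ⨾ Δ₁ ++ fm (A₁ ∧ A₂) ∷ Δ₂ ⟧ ⇒ C

  ∧L₂ : ∀ {u} {S : Calculus u} (Ξ : Context u additive) {ζ Δ₁ Δ₂ A₁ A₂ C} →
        S ⊢ Ξ ⟦ ζ ⨾ Δ₁ ++ fm A₂ ∷ Δ₂ ⟧ ⇒ C →
        S ⊢ Ξ ⟦ ζ ⨾ Δ₁ ++ fm (A₁ ∧ A₂) ∷ Δ₂ ⟧ ⇒ C

  ∧R : ∀ {u} {S : Calculus u} {Ξ : MetaFormula u additive} {A₁ A₂} →
       S ⊢ Ξ ⇒ A₁ →
       S ⊢ Ξ ⇒ A₂ →
       S ⊢ Ξ ⇒ A₁ ∧ A₂

  []⁻¹L : ∀ {u a} {S : Calculus u} (Ξ : Context u a) {ζ Δ₁ Δ₂ A B} →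
          S ⊢ Ξ ⟦ ζ ⨾ Δ₁ ++ fm A ∷ Δ₂ ⟧ ⇒ B →
          S ⊢ Ξ ⟦ ζ ⨾ Δ₁ ++ [ [] ⨾ fm ([]⁻¹ A) ∷ [] ] ∷ Δ₂ ⟧ ⇒ B

  []⁻¹R : ∀ {u a} {S : Calculus u} {Ξ : MetaFormula u a} {A} →
          S ⊢ [] ⨾ [ Ξ ] ∷ [] ⇒ A →
          S ⊢ Ξ ⇒ []⁻¹ A

  ⟨⟩L : ∀ {u a} {S : Calculus u} (Ξ : Context u a) {ζ Δ₁ Δ₂ A B} →
        S ⊢ Ξ ⟦ ζ ⨾ Δ₁ ++ [ [] ⨾ fm A ∷ [] ] ∷ Δ₂ ⟧ ⇒ B →
        S ⊢ Ξ ⟦ ζ ⨾ Δ₁ ++ fm (⟨⟩ A) ∷ Δ₂ ⟧ ⇒ B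

  ⟨⟩R : ∀ {u a} {S : Calculus u} {Ξ : MetaFormula u a} {A} →
        S ⊢ Ξ ⇒ A →
        S ⊢ [] ⨾ [ Ξ ] ∷ [] ⇒ ⟨⟩ A

  !L : ∀ {u a} {S : Calculus u} (Ξ : Context u a) {ζ Γ₁ Γ₂ A B} →
       S ⊢ Ξ ⟦ A ∷ ζ ⨾ Γ₁ ++ Γ₂ ⟧ ⇒ B →
       S ⊢ Ξ ⟦ ζ ⨾ Γ₁ ++ fm (! A) ∷ Γ₂ ⟧ ⇒ B

  !P : ∀ {u a} {S : Calculus u} (Ξ : Context u a) {ζ Γ₁ Γ₂ A B} →
       S ⊢ Ξ ⟦ ζ ⨾ Γ₁ ++ fm A ∷ Γ₂ ⟧ ⇒ B →
       S ⊢ Ξ ⟦ A ∷ ζ ⨾ Γ₁ ++ Γ₂ ⟧ ⇒ B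

  !R′₂₀₁₅ : ∀ {a} {ζ : Stoup unital a} {B} →
            ζ ≢ [] →
            M′₂₀₁₅ ⊢ ζ ⨾ [] ⇒ B →
            M′₂₀₁₅ ⊢ ζ ⨾ [] ⇒ ! B

  !C′₂₀₁₅ : ∀ {a} (Ξ : Context unital a) {ζ₁ ζ₂ ζ′ Γ₁ Γ₂ Γ₃ C} →
            ζ₂ ≢ [] →
            M′₂₀₁₅ ⊢ Ξ ⟦ ζ₁ ++ ζ₂ ⨾ Γ₁ ++ [ ζ′ ++ ζ₂ ⨾ Γ₂ ] ∷ Γ₃ ⟧ ⇒ C →
            M′₂₀₁₅ ⊢ Ξ ⟦ ζ₁ ++ ζ₂ ++ ζ′ ⨾ Γ₁ ++ Γ₂ ++ Γ₃ ⟧ ⇒ C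

  !R′₂₀₁₈ : ∀ {u a} {S : Calculus u} {A B : Formula u a} →
            Is2018 S →
            S ⊢ A ∷ [] ⨾ [] ⇒ B →
            S ⊢ A ∷ [] ⨾ [] ⇒ ! B

  !C′₂₀₁₈ : ∀ {u a} {S : Calculus u} (Ξ : Context u a) {ζ ζ′ Γ₁ Γ₂ Γ₃ A B} →
            Is2018 S →
            Admissible S ζ′ Γ₂ →
            S ⊢ Ξ ⟦ A ∷ ζ ⨾ Γ₁ ++ [ A ∷ ζ′ ⨾ Γ₂ ] ∷ Γ₃ ⟧ ⇒ B →
            S ⊢ Ξ ⟦ A ∷ ζ ⨾ Γ₁ ++ [ [] ⨾ [ ζ′ ⨾ Γ₂ ] ∷ [] ] ∷ Γ₃ ⟧ ⇒ B

------------------------------------------------------------------------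
-- Sequents as words over a finite alphabet

data Letter : Set where
  `tick `var `𝟏 `╲ `╱ `· `∧ `∨ `⟨⟩ `[]⁻¹ `! `[ `] `⨾ `⇒ : Letter

-- Polish notation; the n-th variable is n ticks followed by `var.

formulaCode : ∀ {u a} → Formula u a → List Letter
formulaCode (var n)  = replicate n `tick ++ `var ∷ []
formulaCode 𝟏        = `𝟏 ∷ []
formulaCode (A ╲ B)  = `╲ ∷ formulaCode A ++ formulaCode B
formulaCode (A ╱ B)  = `╱ ∷ formulaCode A ++ formulaCode B
formulaCode (A · B)  = `· ∷ formulaCode A ++ formulaCode B
formulaCode (A ∧ B)  = `∧ ∷ formulaCode A ++ formulaCode B
formulaCode (A ∨ B)  = `∨ ∷ formulaCode A ++ formulaCode B
formulaCode (⟨⟩ A)   = `⟨⟩ ∷ formulaCode A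
formulaCode ([]⁻¹ A) = `[]⁻¹ ∷ formulaCode A
formulaCode (! A)    = `! ∷ formulaCode A

stoupCode : ∀ {u a} → Stoup u a → List Letter
stoupCode []      = []
stoupCode (A ∷ ζ) = formulaCode A ++ stoupCode ζ

mutual
  treeCode : ∀ {u a} → TreeTerm u a → List Letter
  treeCode (fm A) = formulaCode A
  treeCode [ Ξ ]  = `[ ∷ metaCode Ξ ++ `] ∷ []

  treesCode : ∀ {u a} → List (TreeTerm u a) → List Letter
  treesCode []      = []
  treesCode (T ∷ Γ) = treeCode T ++ treesCode Γ

  metaCode : ∀ {u a} → MetaFormula u a → List Letter
  metaCode (ζ ⨾ Γ) = stoupCode ζ ++ `⨾ ∷ treesCode Γ

sequentCode : ∀ {u a} → Sequent u a → List Letter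
sequentCode (Ξ ⇒ C) = metaCode Ξ ++ `⇒ ∷ formulaCode C

-- The code is unambiguous: reading a word from right to left with a stack
-- of sequences recovers the sequent.

private
  Stack : Units → Additives → Set
  Stack u a = List (List (TreeTerm u a))

  formulas : ∀ {u a} → List (TreeTerm u a) → Maybe (Stoup u a)
  formulas []         = just []
  formulas (fm A ∷ Γ) = formulas Γ >>= λ ζ → just (A ∷ ζ)
  formulas ([ _ ] ∷ Γ) = nothing

  read : ∀ {u a} → Letter → Stack u a → Maybe (Stack u a)
  read          `tick ((fm (var n) ∷ Δ) ∷ s)   = just ((fm (var (suc n)) ∷ Δ) ∷ s)
  read          `var  (Δ ∷ s)                  = just ((fm (var zero) ∷ Δ) ∷ s)
  read {unital} `𝟏    (Δ ∷ s)                  = just ((fm 𝟏 ∷ Δ) ∷ s)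
  read          `╲    ((fm A ∷ fm B ∷ Δ) ∷ s)  = just ((fm (A ╲ B) ∷ Δ) ∷ s)
  read          `╱    ((fm A ∷ fm B ∷ Δ) ∷ s)  = just ((fm (A ╱ B) ∷ Δ) ∷ s)
  read          `·    ((fm A ∷ fm B ∷ Δ) ∷ s)  = just ((fm (A · B) ∷ Δ) ∷ s)
  read {_} {additive} `∧ ((fm A ∷ fm B ∷ Δ) ∷ s) = just ((fm (A ∧ B) ∷ Δ) ∷ s)
  read {_} {additive} `∨ ((fm A ∷ fm B ∷ Δ) ∷ s) = just ((fm (A ∨ B) ∷ Δ) ∷ s)
  read          `⟨⟩   ((fm A ∷ Δ) ∷ s)         = just ((fm (⟨⟩ A) ∷ Δ) ∷ s)
  read          `[]⁻¹ ((fm A ∷ Δ) ∷ s)         = just ((fm ([]⁻¹ A) ∷ Δ) ∷ s)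
  read          `!    ((fm A ∷ Δ) ∷ s)         = just ((fm (! A) ∷ Δ) ∷ s)
  read          `[    (Φ ∷ Γ ∷ Δ ∷ s)          =
    formulas Φ >>= λ ζ → just (([ ζ ⨾ Γ ] ∷ Δ) ∷ s)
  read          `]    s                        = just ([] ∷ s)
  read          `⨾    s                        = just ([] ∷ s)
  read          `⇒    s                        = just ([] ∷ s)
  read          _     _                        = nothing

  decode : ∀ {u a} → List Letter → Maybe (Stack u a)
  decode []      = just ([] ∷ [])
  decode (l ∷ w) = decode w >>= read l

  formulas-map : ∀ {u a} (ζ : Stoup u a) → formulas (map fm ζ) ≡ just ζ
  formulas-map []      = refl
  formulas-map (A ∷ ζ) rewrite formulas-map ζ = refl

  decode-var : ∀ {u a} n {w Δ} {s : Stack u a} → decode w ≡ just (Δ ∷ s) →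
               decode ((replicate n `tick ++ `var ∷ []) ++ w) ≡ just ((fm (var n) ∷ Δ) ∷ s)
  decode-var zero    p rewrite p = refl
  decode-var {u} {a} (suc n) {w} {Δ} {s} p
    rewrite decode-var {u} {a} n {w} {Δ} {s} p = refl

  mutual
    decode-formula : ∀ {u a} (A : Formula u a) {w Δ} {s : Stack u a} →
                     decode w ≡ just (Δ ∷ s) →
                     decode (formulaCode A ++ w) ≡ just ((fm A ∷ Δ) ∷ s)
    decode-formula (var n)  p = decode-var n p
    decode-formula 𝟏        p rewrite p = refl
    decode-formula (A ╲ B)  p = cong (_>>= read `╲) (decode-pair A B p)
    decode-formula (A ╱ B)  p = cong (_>>= read `╱) (decode-pair A B p)
    decode-formula (A · B)  p = cong (_>>= read `·) (decode-pair A B p)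
    decode-formula (A ∧ B)  p = cong (_>>= read `∧) (decode-pair A B p)
    decode-formula (A ∨ B)  p = cong (_>>= read `∨) (decode-pair A B p)
    decode-formula (⟨⟩ A)   p = cong (_>>= read `⟨⟩) (decode-formula A p)
    decode-formula ([]⁻¹ A) p = cong (_>>= read `[]⁻¹) (decode-formula A p)
    decode-formula (! A)    p = cong (_>>= read `!) (decode-formula A p)

    decode-pair : ∀ {u a} (A B : Formula u a) {w Δ} {s : Stack u a} →
                  decode w ≡ just (Δ ∷ s) →
                  decode ((formulaCode A ++ formulaCode B) ++ w) ≡
                  just ((fm A ∷ fm B ∷ Δ) ∷ s)
    decode-pair A B {w} p rewrite ++-assoc (formulaCode A) (formulaCode B) w =
      decode-formula A (decode-formula B p)

  decode-stoup : ∀ {u a} (ζ : Stoup u a) {w} {s : Stack u a} →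
                 decode w ≡ just ([] ∷ s) →
                 decode (stoupCode ζ ++ w) ≡ just (map fm ζ ∷ s)
  decode-stoup []      p = p
  decode-stoup (A ∷ ζ) {w} p rewrite ++-assoc (formulaCode A) (stoupCode ζ) w =
    decode-formula A (decode-stoup ζ p)

  mutual
    decode-tree : ∀ {u a} (T : TreeTerm u a) {w Δ} {s : Stack u a} →
                  decode w ≡ just (Δ ∷ s) →
                  decode (treeCode T ++ w) ≡ just ((T ∷ Δ) ∷ s)
    decode-tree (fm A) p = decode-formula A p
    decode-tree {u} {a} [ ζ ⨾ Γ ] {w} {Δ} {s} p
      rewrite ++-assoc (metaCode (ζ ⨾ Γ)) (`] ∷ []) w
            | decode-meta ζ Γ {`] ∷ w} {Δ ∷ s} (cong (_>>= read `]) p)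
            | formulas-map ζ = refl

    decode-trees : ∀ {u a} (Γ : List (TreeTerm u a)) {w} {s : Stack u a} →
                   decode w ≡ just ([] ∷ s) →
                   decode (treesCode Γ ++ w) ≡ just (Γ ∷ s)
    decode-trees []      p = p
    decode-trees (T ∷ Γ) {w} p rewrite ++-assoc (treeCode T) (treesCode Γ) w =
      decode-tree T (decode-trees Γ p)

    decode-meta : ∀ {u a} (ζ : Stoup u a) Γ {w} {s : Stack u a} →
                  decode w ≡ just ([] ∷ s) →
                  decode (metaCode (ζ ⨾ Γ) ++ w) ≡ just (map fm ζ ∷ Γ ∷ s)
    decode-meta ζ Γ {w} p rewrite ++-assoc (stoupCode ζ) (`⨾ ∷ treesCode Γ) w =
      decode-stoup ζ (cong (_>>= read `⨾) (decode-trees Γ p))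

  decode-sequent : ∀ {u a} (ζ : Stoup u a) Γ C →
                   decode (sequentCode (ζ ⨾ Γ ⇒ C)) ≡
                   just (map fm ζ ∷ Γ ∷ (fm C ∷ []) ∷ [])
  decode-sequent ζ Γ C = decode-meta ζ Γ (cong (_>>= read `⇒) decode-C)
    where
    decode-C : decode (formulaCode C) ≡ just ((fm C ∷ []) ∷ [])
    decode-C = trans (cong decode (sym (++-identityʳ (formulaCode C))))
                     (decode-formula C refl)

  map-fm-injective : ∀ {u a} (ζ ζ′ : Stoup u a) → map fm ζ ≡ map fm ζ′ → ζ ≡ ζ′
  map-fm-injective ζ ζ′ eq =
    just-injective (trans (sym (formulas-map ζ)) (trans (cong formulas eq) (formulas-map ζ′)))

sequentCode-injective : ∀ {u a} {s t : Sequent u a} →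
                        sequentCode s ≡ sequentCode t → s ≡ t
sequentCode-injective {s = ζ ⨾ Γ ⇒ C} {t = ζ′ ⨾ Γ′ ⇒ C′} eq
  with just-injective
         (trans (sym (decode-sequent ζ Γ C)) (trans (cong decode eq) (decode-sequent ζ′ Γ′ C′)))
... | stacks
  with map-fm-injective ζ ζ′ (∷-injectiveˡ stacks) | ∷-injectiveʳ stacks
... | refl | refl = refl

code : ∀ {u a} → Sequent u a ↣ List Letter
code = mk↣ sequentCode-injective

------------------------------------------------------------------------
-- Turing machines and decidability

data Move : Set where
  left right : Move

-- Deterministic machines with one two-way infinite tape that halt with a
-- Boolean answer.  A tape symbol is blank (`nothing`), a letter of the input
-- alphabet Σ, which is meant to be finite, or one of finitely many auxiliary
-- symbols.

TapeSymbol : Set → ℕ → Set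
TapeSymbol Σ auxiliaries = Maybe (Σ ⊎ Fin auxiliaries)

data Action (State Symbol : Set) : Set where
  halt           : Bool → Action State Symbol
  write_move_to_ : Symbol → Move → State → Action State Symbol

record TuringMachine (Σ : Set) : Set where
  field
    states auxiliaries : ℕ

  State  = Fin states
  Symbol = TapeSymbol Σ auxiliaries

  field
    start      : State
    transition : State → Symbol → Action State Symbol

-- The tape lists are ordered outwards from the scanned cell; all cells
-- beyond them are blank.

record Tape (Symbol : Set) : Set where
  constructor tape
  field
    leftward  : List Symbol
    scanned   : Symbol
    rightward : List Symbol

module _ {A : Set} where

  shift : Move → Tape (Maybe A) → Tape (Maybe A)
  shift left  (tape []      x rs)       = tape [] nothing (x ∷ rs)
  shift left  (tape (l ∷ ls) x rs)      = tape ls l (x ∷ rs)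
  shift right (tape ls      x [])       = tape (x ∷ ls) nothing []
  shift right (tape ls      x (r ∷ rs)) = tape (x ∷ ls) r rs

  initial : List (Maybe A) → Tape (Maybe A)
  initial []       = tape [] nothing []
  initial (x ∷ xs) = tape [] x xs

module _ {Σ : Set} (M : TuringMachine Σ) where
  open TuringMachine M

  -- Run q t b: started in state q on tape t, M halts with answer b.

  data Run (q : State) : Tape Symbol → Bool → Set where
    halts : ∀ {ls x rs b} →
            transition q x ≡ halt b →
            Run q (tape ls x rs) b
    steps : ∀ {ls x rs y m q′ b} →
            transition q x ≡ write y move m to q′ →
            Run q′ (shift m (tape ls y rs)) b →
            Run q (tape ls x rs) b

  Answers : List Σ → Bool → Set
  Answers w b = Run start (initial (map (λ l → just (inj₁ l)) w)) b

-- Behaviour is only required on words that are codes.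

Decides : {A Σ : Set} → TuringMachine Σ → A ↣ List Σ → (A → Set) → Set
Decides M code P =
  ∀ x → (P x → Answers M (to x) true) × (¬ P x → Answers M (to x) false)
  where open Injection code using (to)

AlgorithmicallyUndecidable : {A Σ : Set} → A ↣ List Σ → (A → Set) → Set
AlgorithmicallyUndecidable code P = ¬ (∃[ M ] Decides M code P)

DerivabilityUndecidable : ∀ {u} → Calculus u → Additives → Set
DerivabilityUndecidable {u} S a =
  AlgorithmicallyUndecidable (code {u} {a}) (S ⊢_)

{-# OPTIONS --safe #-}

-- Soundness side: forget the brackets and read formulae as closed sets of
-- words in a phase model whose pole is the set of words that a rewriting
-- system reduces to its final symbol; a formula in the stoup says that it
-- contains the empty word.  All rules of the three calculi are then valid, and
-- if w ⇒ v is a rewriting rule, then v ╱ w is a true formula.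
--
-- Completeness side: the rewriting system moves a single head, and its rules
-- are formulae in the stoup.  A copy of a rule is obtained inside a bracket
-- around the head alone, where []⁻¹ then cancels that bracket.  In the 2018
-- calculi the double bracket that contraction asks for is supplied by
-- representing the head q as ⟨⟩⟨⟩q.
--
-- Diagonalization: given a decider M, the configuration encoded in the sequent
-- contains the code of the remaining, fixed part of the sequent, so that the
-- head can write down the code of the whole sequent and run M on it.  It reaches
-- the final configuration exactly when M answers that the sequent is
-- underivable.

module Submission where

open import Data.Bool.Base using (Bool; true; false)
open import Data.Empty using (⊥-elim)
open import Data.Fin.Base using (Fin; zero; suc; toℕ)
open import Data.Fin.Properties using (toℕ-injective)
open import Data.List.Base
  using (List; []; _∷_; _++_; _ʳ++_; map; reverse; foldl; foldr; lookup; concatMap; fromMaybe;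
         cartesianProduct; allFin)
open import Data.List.Membership.Propositional using (_∈_)
open import Data.List.Membership.Propositional.Properties
  using (∈-map⁺; ∈-++⁺ˡ; ∈-++⁺ʳ; ∈-∃++; ∈-cartesianProduct⁺; ∈-allFin)
open import Data.List.Properties
  using (++-assoc; ++-identityʳ; map-++; map-ʳ++; ++-ʳ++; ʳ++-defn; reverse-map;
         reverse-involutive; reverse-++; ∷-injectiveˡ; ∷-injectiveʳ)
open import Data.List.Relation.Binary.Permutation.Propositional using (↭-sym)
open import Data.List.Relation.Binary.Permutation.Propositional.Properties
  using (All-resp-↭; ++-comm) renaming (shift to ↭-shift)
open import Data.List.Relation.Unary.All using (All; []; _∷_; universal)
open import Data.List.Relation.Unary.All.Properties using (map⁺; ++⁺; ++⁻ˡ; ++⁻ʳ)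
open import Data.List.Relation.Unary.Any using (here; there; index)
open import Data.List.Relation.Unary.Any.Properties using (lookup-index)
open import Data.Maybe.Base using (Maybe; just; nothing)
open import Data.Nat.Base using (ℕ)
open import Data.Product.Base using (_×_; _,_; proj₁; proj₂; ∃-syntax)
open import Data.Sum.Base using (_⊎_; inj₁; inj₂)
open import Level using (0ℓ)
open import Relation.Binary.Construct.Closure.ReflexiveTransitive using (Star; ε; _◅_; _◅◅_)
open import Relation.Binary.PropositionalEquality
  using (_≡_; _≢_; refl; sym; trans; cong; cong₂; subst; subst₂; module ≡-Reasoning)
open import Relation.Nullary.Negation.Core using (¬_)
open import Relation.Unary using (Pred; _⊆_)
open import Defs

-- Regrouping and reversing lists

++-assoc-frame : ∀ {X : Set} (c a x b d : List X) →
                 c ++ (a ++ x ++ b) ++ d ≡ (c ++ a) ++ x ++ b ++ d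
++-assoc-frame c a x b d = begin
  c ++ (a ++ x ++ b) ++ d     ≡⟨ cong (c ++_) (++-assoc a (x ++ b) d) ⟩
  c ++ a ++ (x ++ b) ++ d     ≡⟨ cong (λ y → c ++ a ++ y) (++-assoc x b d) ⟩
  c ++ a ++ x ++ b ++ d       ≡⟨ ++-assoc c a (x ++ b ++ d) ⟨
  (c ++ a) ++ x ++ b ++ d     ∎
  where open ≡-Reasoning

ʳ++-++ : ∀ {A : Set} (xs : List A) {ys zs} → (xs ʳ++ ys) ++ zs ≡ xs ʳ++ ys ++ zs
ʳ++-++ []       = refl
ʳ++-++ (_ ∷ xs) = ʳ++-++ xs

++-ʳ++-split : ∀ {A : Set} (ws xs : List A) {ys} → ws ++ (xs ʳ++ ys) ≡ (ws ++ (xs ʳ++ [])) ++ ys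
++-ʳ++-split ws xs {ys} =
  trans (cong (ws ++_) (sym (ʳ++-++ xs))) (sym (++-assoc ws (xs ʳ++ []) ys))

ʳ++-≢-singleton : ∀ {A : Set} (xs : List A) {x y ys z} → xs ʳ++ x ∷ y ∷ ys ≢ z ∷ []
ʳ++-≢-singleton []       ()
ʳ++-≢-singleton (_ ∷ xs) eq = ʳ++-≢-singleton xs eq

-- Phase semantics and soundness

module Semantics {Sym : Set} (name : Sym → ℕ) (Pole : Pred (List Sym) 0ℓ) where

  Lang : Set₁
  Lang = Pred (List Sym) 0ℓ

  infixr 6 _∙_

  _∙_ : Lang → Lang → Lang
  (X ∙ Y) w = ∃[ u ] ∃[ v ] X u × Y v × w ≡ u ++ v

  -- The biorthogonal closure of phase semantics: a test is a two-sided context, passed when the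
  -- filled word lies in `Pole`.
  Closure : Lang → Lang
  Closure X w = ∀ a b → (∀ {x} → X x → Pole (a ++ x ++ b)) → Pole (a ++ w ++ b)

  ⟪_⟫ : ∀ {u} → Formula u multiplicative → Lang
  ⟪ var n ⟫  = Closure (λ w → ∃[ s ] name s ≡ n × w ≡ s ∷ [])
  ⟪ 𝟏 ⟫      = Closure (_≡ [])
  ⟪ A ╲ B ⟫  = λ w → ∀ {v} → ⟪ A ⟫ v → ⟪ B ⟫ (v ++ w)
  ⟪ B ╱ A ⟫  = λ w → ∀ {v} → ⟪ A ⟫ v → ⟪ B ⟫ (w ++ v)
  ⟪ A · B ⟫  = Closure (⟪ A ⟫ ∙ ⟪ B ⟫)
  ⟪ ⟨⟩ A ⟫   = ⟪ A ⟫
  ⟪ []⁻¹ A ⟫ = ⟪ A ⟫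
  ⟪ ! A ⟫    = Closure (λ w → w ≡ [] × ⟪ A ⟫ [])

  Holds : ∀ {u} → Stoup u multiplicative → Set
  Holds = All (λ A → ⟪ A ⟫ [])

  mutual
    ⟪_⟫ᵗ : ∀ {u} → TreeTerm u multiplicative → Lang
    ⟪ fm A ⟫ᵗ  = ⟪ A ⟫
    ⟪ [ Ξ ] ⟫ᵗ = ⟪ Ξ ⟫ᵐ

    ⟪_⟫* : ∀ {u} → List (TreeTerm u multiplicative) → Lang
    ⟪ [] ⟫*    = _≡ []
    ⟪ T ∷ Γ ⟫* = ⟪ T ⟫ᵗ ∙ ⟪ Γ ⟫*

    ⟪_⟫ᵐ : ∀ {u} → MetaFormula u multiplicative → Lang
    ⟪ ζ ⨾ Γ ⟫ᵐ w = Holds ζ × ⟪ Γ ⟫* w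

  Valid : ∀ {u} → Sequent u multiplicative → Set
  Valid (Ξ ⇒ C) = ⟪ Ξ ⟫ᵐ ⊆ ⟪ C ⟫

  η : ∀ {X} → X ⊆ Closure X
  η Xx a b k = k Xx

  -- Testing `a ++ w ++ b` in the context `c`, `d` amounts to testing `w` in `c ++ a`, `b ++ d`.
  closure-frame : ∀ {Z Y : Lang} a b {w} → (∀ {x} → Y x → Closure Z (a ++ x ++ b)) →
                  Closure Y w → Closure Z (a ++ w ++ b)
  closure-frame a b {w} f Yw c d k =
    subst Pole (sym (++-assoc-frame c a w b d))
      (Yw (c ++ a) (b ++ d) λ {x} Yx → subst Pole (++-assoc-frame c a x b d) (f Yx c d k))

  -- Each denotation is closed, so an element of `Closure Y` may be treated as an element of `Y`.
  -- The frame `a`, `b` lets the induction pass through residuals, whose argument `v` is added to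
  -- it.
  extend : ∀ {u} (A : Formula u multiplicative) {Y : Lang} a b {w} →
           (∀ {x} → Y x → ⟪ A ⟫ (a ++ x ++ b)) → Closure Y w → ⟪ A ⟫ (a ++ w ++ b)
  extend (var n)  = closure-frame
  extend 𝟏        = closure-frame
  extend (A ╲ B)  a b {w} f Yw {v} Av =
    subst ⟪ B ⟫ (++-assoc v a (w ++ b))
      (extend B (v ++ a) b (λ {x} Yx → subst ⟪ B ⟫ (sym (++-assoc v a (x ++ b))) (f Yx Av)) Yw)
  extend (B ╱ A)  a b {w} f Yw {v} Av =
    subst ⟪ B ⟫ (sym (++-assoc-frame [] a w b v))
      (extend B a (b ++ v) (λ {x} Yx → subst ⟪ B ⟫ (++-assoc-frame [] a x b v) (f Yx Av)) Yw)
  extend (A · B)  = closure-frame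
  extend (⟨⟩ A)   = extend A
  extend ([]⁻¹ A) = extend A
  extend (! A)    = closure-frame

  extend-[] : ∀ {u} (A : Formula u multiplicative) {Y : Lang} → Y ⊆ ⟪ A ⟫ → Closure Y ⊆ ⟪ A ⟫
  extend-[] A f {w} Yw =
    subst ⟪ A ⟫ (++-identityʳ w)
      (extend A [] [] (λ {x} Yx → subst ⟪ A ⟫ (sym (++-identityʳ x)) (f Yx)) Yw)

  ++-sound : ∀ {u} (Γ Δ : List (TreeTerm u multiplicative)) → ⟪ Γ ⟫* ∙ ⟪ Δ ⟫* ⊆ ⟪ Γ ++ Δ ⟫*
  ++-sound []      Δ (_ , v , refl , Δv , refl) = Δv
  ++-sound (T ∷ Γ) Δ (_ , v , (t , w , Tt , Γw , refl) , Δv , refl) =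
    t , w ++ v , Tt , ++-sound Γ Δ (w , v , Γw , Δv , refl) , ++-assoc t w v

  ++-split : ∀ {u} (Γ Δ : List (TreeTerm u multiplicative)) → ⟪ Γ ++ Δ ⟫* ⊆ ⟪ Γ ⟫* ∙ ⟪ Δ ⟫*
  ++-split []      Δ Δv = [] , _ , refl , Δv , refl
  ++-split (T ∷ Γ) Δ (t , _ , Tt , ΓΔ , refl) with ++-split Γ Δ ΓΔ
  ... | w , v , Γw , Δv , refl = t ++ w , v , (t , w , Tt , Γw , refl) , Δv , sym (++-assoc t w v)

  singleton-split : ∀ {u} {T : TreeTerm u multiplicative} → ⟪ T ∷ [] ⟫* ⊆ ⟪ T ⟫ᵗ
  singleton-split {T = T} (t , _ , Tt , refl , refl) = subst ⟪ T ⟫ᵗ (sym (++-identityʳ t)) Tt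

  singleton-sound : ∀ {u} {T : TreeTerm u multiplicative} → ⟪ T ⟫ᵗ ⊆ ⟪ T ∷ [] ⟫*
  singleton-sound {x = w} Tw = w , [] , Tw , refl , sym (++-identityʳ w)

  -- With brackets forgotten, a context of any depth is a pair of words `a`, `b` around the
  -- designated part, and it does not depend on that part.
  focus : ∀ {u} (Ξ : Context u multiplicative) {ζ Γ w} Δ₁ Δ₂ →
          ⟪ Ξ ⟦ ζ ⨾ Δ₁ ++ Γ ++ Δ₂ ⟧ ⟫ᵐ w →
          ∃[ a ] ∃[ b ] ∃[ y ] w ≡ a ++ y ++ b × Holds ζ × ⟪ Γ ⟫* y ×
            (∀ {ζ′ Γ′ x} → Holds ζ′ → ⟪ Γ′ ⟫* x → ⟪ Ξ ⟦ ζ′ ⨾ Δ₁ ++ Γ′ ++ Δ₂ ⟧ ⟫ᵐ (a ++ x ++ b))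
  focus □ {Γ = Γ} Δ₁ Δ₂ (hζ , w∈) with ++-split Δ₁ (Γ ++ Δ₂) w∈
  ... | a , _ , Δa , v∈ , refl with ++-split Γ Δ₂ v∈
  ... | y , b , Γy , Δb , refl = a , b , y , refl , hζ , Γy , λ {ζ′} {Γ′} hζ′ Γ′x →
    hζ′ , ++-sound Δ₁ (Γ′ ++ Δ₂) (a , _ , Δa , ++-sound Γ′ Δ₂ (_ , b , Γ′x , Δb , refl) , refl)
  focus (within ζ₀ Γ₁ Ξ Γ₂) {ζ} {Γ} Δ₁ Δ₂ (hζ₀ , w∈)
    with ++-split Γ₁ ([ Ξ ⟦ ζ ⨾ Δ₁ ++ Γ ++ Δ₂ ⟧ ] ∷ Γ₂) w∈
  ... | c , _ , Γ₁c , (v , d , Ξv , Γ₂d , refl) , refl with focus Ξ Δ₁ Δ₂ Ξv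
  ... | a , b , y , refl , hζ , Γy , k =
    c ++ a , b ++ d , y , ++-assoc-frame c a y b d , hζ , Γy , λ {ζ′} {Γ′} {x} hζ′ Γ′x →
      hζ₀ , ++-sound Γ₁ _ (c , _ , Γ₁c , (a ++ x ++ b , d , k hζ′ Γ′x , Γ₂d , refl) ,
                           sym (++-assoc-frame c a x b d))

  -- The succedent is closed, so a left rule only has to be checked on its active part, and there
  -- only up to closure.
  left-rule : ∀ {u} (Ξ : Context u multiplicative) Δ₁ Δ₂ {ζ ζ′ Γ Γ′ C} →
              ⟪ ζ ⨾ Γ ⟫ᵐ ⊆ Closure ⟪ ζ′ ⨾ Γ′ ⟫ᵐ →
              Valid (Ξ ⟦ ζ′ ⨾ Δ₁ ++ Γ′ ++ Δ₂ ⟧ ⇒ C) →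
              Valid (Ξ ⟦ ζ ⨾ Δ₁ ++ Γ ++ Δ₂ ⟧ ⇒ C)
  left-rule Ξ Δ₁ Δ₂ {C = C} h premise w∈ with focus Ξ Δ₁ Δ₂ w∈
  ... | a , b , y , refl , hζ , Γy , k =
    extend C a b (λ { (hζ′ , Γ′x) → premise (k hζ′ Γ′x) }) (h (hζ , Γy))

  sound : ∀ {u} {S : Calculus u} {s : Sequent u multiplicative} → S ⊢ s → Valid s
  sound (exchange Ξ {Γ = Γ} {C} p d) =
    left-rule Ξ [] Γ {Γ = []} {[]} {C}
      (λ { (h , e) → η (All-resp-↭ (↭-sym p) h , e) }) (sound d)
  sound (ax {A = A}) (_ , w∈) = singleton-split {T = fm A} w∈
  sound (╱L Ξ {ζ₁} {ζ₂} {Γ} {Δ₁} {Δ₂} {B} {C} {D} d e) =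
    left-rule Ξ Δ₁ Δ₂ {Γ = fm (C ╱ B) ∷ Γ} {fm C ∷ []} {D}
      (λ { (h , f , g , ff , Γg , refl) →
         η (++⁻ʳ ζ₁ h , singleton-sound {T = fm C} (ff (sound d (++⁻ˡ ζ₁ h , Γg)))) })
      (sound e)
  sound (╱R {Γ = Γ} {B} _ d) {w} (h , Γw) {v} Bv =
    sound d (h , ++-sound Γ _ (w , v , Γw , singleton-sound {T = fm B} Bv , refl))
  sound (╲L Ξ {ζ₁} {ζ₂} {Γ} {Δ₁} {Δ₂} {A} {C} {D} d e) =
    subst (λ Δ → Valid (Ξ ⟦ ζ₁ ++ ζ₂ ⨾ Δ₁ ++ Δ ⟧ ⇒ D)) (++-assoc Γ _ Δ₂)
      (left-rule Ξ Δ₁ Δ₂ {Γ = Γ ++ fm (A ╲ C) ∷ []} {fm C ∷ []} {D} apply (sound e))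
    where
    apply : ⟪ ζ₁ ++ ζ₂ ⨾ Γ ++ fm (A ╲ C) ∷ [] ⟫ᵐ ⊆ Closure ⟪ ζ₂ ⨾ fm C ∷ [] ⟫ᵐ
    apply (h , Γf) with ++-split Γ (fm (A ╲ C) ∷ []) Γf
    ... | g , f , Γg , ff , refl =
      η (++⁻ʳ ζ₁ h , singleton-sound {T = fm C}
          (singleton-split {T = fm (A ╲ C)} ff (sound d (++⁻ˡ ζ₁ h , Γg))))
  sound (╲R _ d) {w} (h , Γw) {v} Av = sound d (h , v , w , Av , Γw , refl)
  sound (·L Ξ {Δ₁ = Δ₁} {Δ₂} {A} {B} {D} d) =
    left-rule Ξ Δ₁ Δ₂ {Γ = fm (A · B) ∷ []} {fm A ∷ fm B ∷ []} {D}
      (λ { (h , AB∈) a b k → singleton-split {T = fm (A · B)} AB∈ a b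
         λ { (s , t , As , Bt , refl) → k (h , s , t , As , singleton-sound {T = fm B} Bt , refl) } })
      (sound d)
  sound (·R {ζ₁ = ζ₁} {Δ = Δ} {Γ} d e) (h , w∈) with ++-split Δ Γ w∈
  ... | s , t , Δs , Γt , refl =
    η (s , t , sound d (++⁻ˡ ζ₁ h , Δs) , sound e (++⁻ʳ ζ₁ h , Γt) , refl)
  sound (𝟏L Ξ {Δ₁ = Δ₁} {Δ₂} {A} d) =
    left-rule Ξ Δ₁ Δ₂ {Γ = fm 𝟏 ∷ []} {[]} {A}
      (λ { (h , w∈) a b k → singleton-split {T = fm (𝟏 {multiplicative})} w∈ a b λ e → k (h , e) })
      (sound d)
  sound 𝟏R (_ , e) = η e
  sound ([]⁻¹L Ξ {Δ₁ = Δ₁} {Δ₂} {A} {B} d) =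
    left-rule Ξ Δ₁ Δ₂ {Γ = [ [] ⨾ fm ([]⁻¹ A) ∷ [] ] ∷ []} {fm A ∷ []} {B}
      (λ { (h , w∈) → η (h , proj₂ (singleton-split {T = [ [] ⨾ fm A ∷ [] ]} w∈)) })
      (sound d)
  sound ([]⁻¹R d) w∈ = sound d ([] , singleton-sound {T = [ _ ]} w∈)
  sound (⟨⟩L Ξ {Δ₁ = Δ₁} {Δ₂} {A} {B} d) =
    left-rule Ξ Δ₁ Δ₂ {Γ = fm (⟨⟩ A) ∷ []} {[ [] ⨾ fm A ∷ [] ] ∷ []} {B}
      (λ { (h , w∈) → η (h , singleton-sound {T = [ [] ⨾ fm A ∷ [] ]} ([] , w∈)) }) (sound d)
  sound (⟨⟩R {Ξ = Ξ} d) (_ , w∈) = sound d (singleton-split {T = [ Ξ ]} w∈)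
  sound (!L Ξ {Γ₁ = Γ₁} {Γ₂} {A} {B} d) =
    left-rule Ξ Γ₁ Γ₂ {Γ = fm (! A) ∷ []} {[]} {B}
      (λ { (h , w∈) a b k → singleton-split {T = fm (! A)} w∈ a b
         λ { (e , Aε) → k (Aε ∷ h , e) } })
      (sound d)
  -- A true formula contains the empty word, so it can be inserted anywhere in the sequence.
  sound (!P Ξ {Γ₁ = Γ₁} {Γ₂} {A} {B} d) =
    left-rule Ξ Γ₁ Γ₂ {Γ = []} {fm A ∷ []} {B}
      (λ { (Aε ∷ h , refl) → η (h , singleton-sound {T = fm A} Aε) }) (sound d)
  sound (!R′₂₀₁₅ _ d) (h , refl) = η (refl , sound d (h , refl))
  -- The truth of a stoup formula can be used repeatedly, which validates contraction.
  sound (!C′₂₀₁₅ Ξ {ζ₁} {ζ₂} {ζ′} {Γ₁} {Γ₂} {Γ₃} {C} _ d) =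
    left-rule Ξ Γ₁ Γ₃ {Γ = Γ₂} {[ ζ′ ++ ζ₂ ⨾ Γ₂ ] ∷ []} {C}
      (λ { (h , w∈) → let h₂ = ++⁻ˡ ζ₂ (++⁻ʳ ζ₁ h) in
         η (++⁺ (++⁻ˡ ζ₁ h) h₂ ,
            singleton-sound {T = [ ζ′ ++ ζ₂ ⨾ Γ₂ ]} (++⁺ (++⁻ʳ ζ₂ (++⁻ʳ ζ₁ h)) h₂ , w∈)) })
      (sound d)
  sound (!R′₂₀₁₈ _ d) (h , refl) = η (refl , sound d (h , refl))
  sound (!C′₂₀₁₈ Ξ {ζ} {ζ′} {Γ₁} {Γ₂} {Γ₃} {A} {B} _ _ d) =
    left-rule Ξ Γ₁ Γ₃ {Γ = [ [] ⨾ [ ζ′ ⨾ Γ₂ ] ∷ [] ] ∷ []} {[ A ∷ ζ′ ⨾ Γ₂ ] ∷ []} {B}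
      (λ { (Aε ∷ h , w∈) →
         let hζ′ , Γw = singleton-split {T = [ ζ′ ⨾ Γ₂ ]}
                          (proj₂ (singleton-split {T = [ [] ⨾ [ ζ′ ⨾ Γ₂ ] ∷ [] ]} w∈))
         in η (Aε ∷ h , singleton-sound {T = [ A ∷ ζ′ ⨾ Γ₂ ]} (Aε ∷ hζ′ , Γw)) })
      (sound d)

-- Finite enumerations

record Enumeration (A : Set) : Set where
  field
    elements : List A
    complete : ∀ a → a ∈ elements

open Enumeration

⊎-enumeration : ∀ {A B : Set} → Enumeration A → Enumeration B → Enumeration (A ⊎ B)
⊎-enumeration as bs .elements = map inj₁ (elements as) ++ map inj₂ (elements bs)
⊎-enumeration as bs .complete (inj₁ a) = ∈-++⁺ˡ (∈-map⁺ inj₁ (complete as a))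
⊎-enumeration as bs .complete (inj₂ b) = ∈-++⁺ʳ _ (∈-map⁺ inj₂ (complete bs b))

×-enumeration : ∀ {A B : Set} → Enumeration A → Enumeration B → Enumeration (A × B)
×-enumeration as bs .elements = cartesianProduct (elements as) (elements bs)
×-enumeration as bs .complete (a , b) = ∈-cartesianProduct⁺ (complete as a) (complete bs b)

-- Configurations and deterministic head machines

-- A head scanning the word between its two lists of cells, both of which are
-- ordered outwards.
record Config (Cell Head : Set) : Set where
  constructor ⟨_∣_∣_⟩
  field
    leftward  : List Cell
    head      : Head
    rightward : List Cell

module _ {Cell Head : Set} where

  flatten : Config Cell Head → List (Cell ⊎ Head)
  flatten ⟨ ls ∣ q ∣ rs ⟩ = map inj₁ ls ʳ++ inj₂ q ∷ map inj₁ rs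

  embed : List Cell → Config Cell Head → List Cell → Config Cell Head
  embed ls ⟨ l ∣ q ∣ r ⟩ rs = ⟨ l ++ ls ∣ q ∣ r ++ rs ⟩

  flatten-embed : ∀ ls c rs →
                  flatten (embed ls c rs) ≡ (map inj₁ ls ʳ++ []) ++ flatten c ++ map inj₁ rs
  flatten-embed ls ⟨ l ∣ q ∣ r ⟩ rs = begin
    map inj₁ (l ++ ls) ʳ++ inj₂ q ∷ map inj₁ (r ++ rs)
      ≡⟨ cong₂ (λ x y → x ʳ++ inj₂ q ∷ y) (map-++ inj₁ l ls) (map-++ inj₁ r rs) ⟩
    (map inj₁ l ++ map inj₁ ls) ʳ++ inj₂ q ∷ map inj₁ r ++ map inj₁ rs
      ≡⟨ ++-ʳ++ (map inj₁ l) ⟩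
    map inj₁ ls ʳ++ map inj₁ l ʳ++ inj₂ q ∷ map inj₁ r ++ map inj₁ rs
      ≡⟨ cong (map inj₁ ls ʳ++_) (ʳ++-++ (map inj₁ l)) ⟨
    map inj₁ ls ʳ++ flatten ⟨ l ∣ q ∣ r ⟩ ++ map inj₁ rs
      ≡⟨ ʳ++-++ (map inj₁ ls) ⟨
    (map inj₁ ls ʳ++ []) ++ flatten ⟨ l ∣ q ∣ r ⟩ ++ map inj₁ rs ∎
    where open ≡-Reasoning

  cells-headless : ∀ (rs : List Cell) a {q : Head} {b} → map inj₁ rs ≢ a ++ inj₂ q ∷ b
  cells-headless (_ ∷ rs) []      ()
  cells-headless (_ ∷ rs) (_ ∷ a) eq = cells-headless rs a (∷-injectiveʳ eq)

  -- The word on the left has a single head letter, so a factor with a head letter in its middle can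
  -- only sit around it.
  cells-head-unique : ∀ (l : List Cell) {p q : Head} {rs : List Cell} a {x y b} →
    map inj₁ l ++ inj₂ p ∷ map inj₁ rs ≡ a ++ inj₁ x ∷ inj₂ q ∷ inj₁ y ∷ b →
    ∃[ l₀ ] ∃[ r₀ ] l ≡ l₀ ++ x ∷ [] × a ≡ map inj₁ l₀ × p ≡ q × rs ≡ y ∷ r₀ × b ≡ map inj₁ r₀
  cells-head-unique []          []      ()
  cells-head-unique []          (_ ∷ a) {x} eq =
    ⊥-elim (cells-headless _ (a ++ inj₁ x ∷ []) (trans (∷-injectiveʳ eq) (sym (++-assoc a _ _))))
  cells-head-unique (_ ∷ [])    {rs = _ ∷ r₀} [] refl = [] , r₀ , refl , refl , refl , refl , refl
  cells-head-unique (_ ∷ [])    {rs = []} [] ()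
  cells-head-unique (_ ∷ _ ∷ _) []      ()
  cells-head-unique (c ∷ l)     (_ ∷ a) eq with refl ← ∷-injectiveˡ eq
    with l₀ , r₀ , refl , refl , rest ← cells-head-unique l a (∷-injectiveʳ eq) =
    c ∷ l₀ , r₀ , refl , refl , rest

  flatten-head-unique : ∀ (ls : List Cell) {p q : Head} {rs : List Cell} a {x y b} →
    flatten ⟨ ls ∣ p ∣ rs ⟩ ≡ a ++ inj₁ x ∷ inj₂ q ∷ inj₁ y ∷ b →
    ∃[ l₀ ] ∃[ r₀ ] ls ≡ x ∷ l₀ × a ≡ map inj₁ l₀ ʳ++ [] × p ≡ q × rs ≡ y ∷ r₀ × b ≡ map inj₁ r₀
  flatten-head-unique ls {p} {rs = rs} a eq
    with cells-head-unique (reverse ls) a (trans (sym flatten-reverse) eq)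
    where
    flatten-reverse : flatten ⟨ ls ∣ p ∣ rs ⟩ ≡ map inj₁ (reverse ls) ++ inj₂ p ∷ map inj₁ rs
    flatten-reverse = trans (ʳ++-defn (map inj₁ ls)) (cong (_++ _) (sym (reverse-map inj₁ ls)))
  ... | l₀ , r₀ , l≡ , refl , rest =
    reverse l₀ , r₀ ,
    trans (sym (reverse-involutive ls)) (trans (cong reverse l≡) (reverse-++ l₀ _)) ,
    trans (cong (map inj₁) (sym (reverse-involutive l₀))) (reverse-map inj₁ (reverse l₀)) ,
    rest

module Machine {Cell Head : Set} (δ : Cell → Head → Cell → Config Cell Head) where

  infix 2 _⟶_ _↠_

  data _⟶_ : Config Cell Head → Config Cell Head → Set where
    move : ∀ {ls x q y rs} → ⟨ x ∷ ls ∣ q ∣ y ∷ rs ⟩ ⟶ embed ls (δ x q y) rs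

  _↠_ : Config Cell Head → Config Cell Head → Set
  _↠_ = Star _⟶_

  -- Both runs take the same steps, and the second ends where no step is possible, so it cannot stop
  -- before the first.
  ↠-confluent : ∀ {c d q} → c ↠ d → c ↠ ⟨ [] ∣ q ∣ [] ⟩ → d ↠ ⟨ [] ∣ q ∣ [] ⟩
  ↠-confluent ε          e          = e
  ↠-confluent (move ◅ d) (move ◅ e) = ↠-confluent d e

  ⟶-deterministic : ∀ {c d e} → c ⟶ d → c ⟶ e → d ≡ e
  ⟶-deterministic move move = refl

  -- By determinism every step from `c` leads back to `c`, which therefore never becomes a
  -- configuration without a step.
  ↠-loop : ∀ {c q} → c ⟶ c → ¬ (c ↠ ⟨ [] ∣ q ∣ [] ⟩)
  ↠-loop s  ε with () ← s
  ↠-loop s  (t ◅ run) with refl ← ⟶-deterministic s t = ↠-loop s run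

-- Contraction and the stoup in the three calculi

wrap : ∀ {u} → Calculus u → Formula u multiplicative → Formula u multiplicative
wrap M′₂₀₁₅  A = A
wrap M′₂₀₁₈  A = ⟨⟩ ⟨⟩ A
wrap M′₂₀₁₈⁻ A = ⟨⟩ ⟨⟩ A

module _
  {u : Units} {ζ : Stoup u multiplicative} {A B C : Formula u multiplicative}
  {Γ₁ Γ₃ : List (TreeTerm u multiplicative)} where

  -- Read upwards, two uses of `⟨⟩L` open a double bracket around `B`, which `!C′₂₀₁₈` trades for a
  -- single one holding a copy of `A`.
  spawn₂₀₁₈ : ∀ {S} → Is2018 S → (∀ {ζ} → Admissible {u} {multiplicative} S ζ (fm B ∷ [])) →
              S ⊢ A ∷ ζ ⨾ Γ₁ ++ [ A ∷ [] ⨾ fm B ∷ [] ] ∷ Γ₃ ⇒ C →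
              S ⊢ A ∷ ζ ⨾ Γ₁ ++ fm (⟨⟩ ⟨⟩ B) ∷ Γ₃ ⇒ C
  spawn₂₀₁₈ is2018 admissible d =
    ⟨⟩L □ {Δ₁ = Γ₁} {Γ₃} (⟨⟩L (within (A ∷ ζ) Γ₁ □ Γ₃) {Δ₁ = []} {[]}
      (!C′₂₀₁₈ □ {Γ₁ = Γ₁} {Γ₃ = Γ₃} is2018 admissible d))

  spawn : ∀ {S} → S ⊢ A ∷ ζ ⨾ Γ₁ ++ [ A ∷ [] ⨾ fm B ∷ [] ] ∷ Γ₃ ⇒ C →
          S ⊢ A ∷ ζ ⨾ Γ₁ ++ fm (wrap S B) ∷ Γ₃ ⇒ C
  -- Here contraction itself creates the bracket around `B`, with `ζ′` empty.
  spawn {M′₂₀₁₅} d =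
    exchange □ (++-comm ζ (A ∷ []))
      (!C′₂₀₁₅ □ {ζ} {A ∷ []} {[]} {Γ₁} {fm B ∷ []} {Γ₃} (λ ())
        (exchange □ (++-comm (A ∷ []) ζ) d))
  spawn {M′₂₀₁₈}  = spawn₂₀₁₈ full _
  spawn {M′₂₀₁₈⁻} = spawn₂₀₁₈ restricted (inj₁ λ ())

-- There is no weakening, so the stoup is finally absorbed by factors ! R.
retain : ∀ {u} → Stoup u multiplicative → Formula u multiplicative → Formula u multiplicative
retain ζ G = foldr (λ R B → ! R · B) G ζ

!-intro : ∀ {u} (S : Calculus u) {A : Formula u multiplicative} → S ⊢ A ∷ [] ⨾ [] ⇒ ! A
!-intro M′₂₀₁₅  = !R′₂₀₁₅ (λ ()) (!P □ {Γ₁ = []} ax)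
!-intro M′₂₀₁₈  = !R′₂₀₁₈ full (!P □ {Γ₁ = []} ax)
!-intro M′₂₀₁₈⁻ = !R′₂₀₁₈ restricted (!P □ {Γ₁ = []} ax)

retain-intro : ∀ {u} (S : Calculus u) ζ {A} → S ⊢ ζ ⨾ fm A ∷ [] ⇒ retain ζ A
retain-intro S []      = ax
retain-intro S (R ∷ ζ) = ·R (!-intro S) (retain-intro S ζ)

-- Encoding of head machines by sequents

module Encoding
  {Cell Head : Set} (cells : Enumeration Cell) (heads : Enumeration Head)
  {u : Units} (S : Calculus u) where

  symbols : Enumeration (Cell ⊎ Head)
  symbols = ⊎-enumeration cells heads

  name : Cell ⊎ Head → ℕ
  name s = toℕ (index (complete symbols s))

  name-injective : ∀ s t → name s ≡ name t → s ≡ t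
  name-injective s t eq = begin
    s                                                      ≡⟨ lookup-index (complete symbols s) ⟩
    lookup (elements symbols) (index (complete symbols s))
      ≡⟨ cong (lookup (elements symbols)) (toℕ-injective eq) ⟩
    lookup (elements symbols) (index (complete symbols t)) ≡⟨ lookup-index (complete symbols t) ⟨
    t                                                      ∎
    where open ≡-Reasoning

  letter : Cell ⊎ Head → Formula u multiplicative
  letter (inj₁ x) = var (name (inj₁ x))
  letter (inj₂ q) = wrap S (var (name (inj₂ q)))

  trees : List (Cell ⊎ Head) → List (TreeTerm u multiplicative)
  trees = map (λ s → fm (letter s))

  -- The product of the letters of `flatten c`, associated from the head outwards because both cell
  -- lists run outwards.
  output : Config Cell Head → Formula u multiplicative
  output ⟨ l ∣ q ∣ r ⟩ =
    foldl (λ A x → letter (inj₁ x) · A) (foldl (λ A y → A · letter (inj₁ y)) (letter (inj₂ q)) r) l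

  module Reduction (δ : Cell → Head → Cell → Config Cell Head) (final : Head) where

    open Machine δ

    -- The copy consumes the head inside its bracket, []⁻¹ cancels the bracket,
    -- and what remains consumes the neighbouring cells.
    rule : Cell × Head × Cell → Formula u multiplicative
    rule (x , q , y) =
      []⁻¹ ((letter (inj₁ x) ╲ output (δ x q y)) ╱ letter (inj₁ y)) ╱ var (name (inj₂ q))

    rules : Stoup u multiplicative
    rules = map rule (elements (×-enumeration cells (×-enumeration heads cells)))

    goal : Formula u multiplicative
    goal = letter (inj₂ final)

    -- It closes the derivation: once only the final head is left, head and stoup together supply
    -- the argument `retain rules goal`.
    collector : Formula u multiplicative
    collector = goal ╱ retain rules goal

    sequent : Config Cell Head → Sequent u multiplicative
    sequent c = rules ⨾ fm collector ∷ trees (flatten c) ⇒ goal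

    module _ {ζ : Stoup u multiplicative} {C : Formula u multiplicative} where

      rightward-elim : ∀ {A} Δ₁ r {Δ₂} →
        S ⊢ ζ ⨾ Δ₁ ++ fm A ∷ trees (map inj₁ r) ++ Δ₂ ⇒ C →
        S ⊢ ζ ⨾ Δ₁ ++ fm (foldl (λ A y → A · letter (inj₁ y)) A r) ∷ Δ₂ ⇒ C
      rightward-elim Δ₁ []      d = d
      rightward-elim Δ₁ (y ∷ r) d = rightward-elim Δ₁ r (·L □ {Δ₁ = Δ₁} d)

      leftward-elim : ∀ {A} Δ₁ l {Δ₂} →
        S ⊢ ζ ⨾ Δ₁ ++ (trees (map inj₁ l) ʳ++ fm A ∷ Δ₂) ⇒ C →
        S ⊢ ζ ⨾ Δ₁ ++ fm (foldl (λ A x → letter (inj₁ x) · A) A l) ∷ Δ₂ ⇒ C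
      leftward-elim Δ₁ []      d = d
      leftward-elim Δ₁ (x ∷ l) d =
        leftward-elim Δ₁ l (subst (λ Γ → S ⊢ ζ ⨾ Γ ⇒ C) (sym (++-ʳ++-split Δ₁ L))
          (·L □ {Δ₁ = Δ₁ ++ (L ʳ++ [])} (subst (λ Γ → S ⊢ ζ ⨾ Γ ⇒ C) (++-ʳ++-split Δ₁ L) d)))
        where L = trees (map inj₁ l)

      output-elim : ∀ c Δ₁ {Δ₂} → S ⊢ ζ ⨾ Δ₁ ++ trees (flatten c) ++ Δ₂ ⇒ C →
                    S ⊢ ζ ⨾ Δ₁ ++ fm (output c) ∷ Δ₂ ⇒ C
      output-elim ⟨ l ∣ q ∣ r ⟩ Δ₁ {Δ₂} d =
        leftward-elim Δ₁ l (subst (λ Γ → S ⊢ ζ ⨾ Γ ⇒ C) (sym (++-ʳ++-split Δ₁ L))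
          (rightward-elim (Δ₁ ++ (L ʳ++ [])) r (subst (λ Γ → S ⊢ ζ ⨾ Γ ⇒ C) regroup d)))
        where
        L = trees (map inj₁ l)
        R = fm (letter (inj₂ q)) ∷ trees (map inj₁ r)
        regroup : Δ₁ ++ trees (flatten ⟨ l ∣ q ∣ r ⟩) ++ Δ₂ ≡ (Δ₁ ++ (L ʳ++ [])) ++ R ++ Δ₂
        regroup = begin
          Δ₁ ++ trees (flatten ⟨ l ∣ q ∣ r ⟩) ++ Δ₂
            ≡⟨ cong (λ Γ → Δ₁ ++ Γ ++ Δ₂) (map-ʳ++ _ (map inj₁ l)) ⟩
          Δ₁ ++ (L ʳ++ R) ++ Δ₂           ≡⟨ cong (Δ₁ ++_) (ʳ++-++ L) ⟩
          Δ₁ ++ (L ʳ++ R ++ Δ₂)           ≡⟨ ++-ʳ++-split Δ₁ L ⟩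
          (Δ₁ ++ (L ʳ++ [])) ++ R ++ Δ₂   ∎
          where open ≡-Reasoning

    -- Upwards: `spawn` unwraps the head into a bracket with a copy of the rule, whose outermost
    -- argument is therefore the bare variable. The copy takes this variable, loses the bracket,
    -- takes `Y` and `X`, and its product unfolds into letters. The rule itself stays in the stoup
    -- for later steps.
    apply-rule : ∀ {C} x q y Δ₁ {Δ₂} →
      S ⊢ rules ⨾ Δ₁ ++ trees (flatten (δ x q y)) ++ Δ₂ ⇒ C →
      S ⊢ rules ⨾ Δ₁ ++ trees (inj₁ x ∷ inj₂ q ∷ inj₁ y ∷ []) ++ Δ₂ ⇒ C
    apply-rule {C} x q y Δ₁ {Δ₂} d
      with as , bs , eq ← ∈-∃++ (∈-map⁺ rule (complete (×-enumeration cells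
                                  (×-enumeration heads cells)) (x , q , y))) =
      subst (λ ζ → S ⊢ ζ ⨾ _ ⇒ C) (sym eq) (exchange □ (↭-sym (↭-shift _ as bs))
        (subst (λ Γ → S ⊢ ζ ⨾ Γ ⇒ C) (++-assoc Δ₁ (X ∷ []) _)
          (spawn {Γ₁ = Δ₁ ++ X ∷ []}
            -- The copy enters to the left of the head, since `╱` takes its argument from the right.
            (!P (within ζ (Δ₁ ++ X ∷ []) □ (Y ∷ Δ₂)) {Γ₁ = []}
              (╱L (within ζ (Δ₁ ++ X ∷ []) □ (Y ∷ Δ₂)) {[]} {[]} {Q ∷ []} {[]} {[]} ax
                ([]⁻¹L □ {Δ₁ = Δ₁ ++ X ∷ []}
                  (╱L □ {[]} {Γ = Y ∷ []} {Δ₁ ++ X ∷ []} ax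
                    (subst (λ Γ → S ⊢ ζ ⨾ Γ ⇒ C) (sym (++-assoc Δ₁ (X ∷ []) _))
                      (╲L □ {[]} {Γ = X ∷ []} {Δ₁} ax
                        (output-elim (δ x q y) Δ₁
                          (exchange □ (↭-shift _ as bs)
                            (subst (λ ζ → S ⊢ ζ ⨾ _ ⇒ C) eq d))))))))))))
      where
      ζ = rule (x , q , y) ∷ as ++ bs
      X = fm (letter (inj₁ x))
      Q = fm (var (name (inj₂ q)))
      Y = fm (letter (inj₁ y))

    complete-step : ∀ {c d} → c ⟶ d → S ⊢ sequent d → S ⊢ sequent c
    complete-step (move {ls} {x} {q} {y} {rs}) d =
      subst (λ Γ → S ⊢ rules ⨾ Γ ⇒ goal) (sym before)
        (apply-rule x q y Δ (subst (λ Γ → S ⊢ rules ⨾ Γ ⇒ goal) after d))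
      where
      L = trees (map inj₁ ls)
      Δ = fm collector ∷ (L ʳ++ [])
      after : fm collector ∷ trees (flatten (embed ls (δ x q y) rs)) ≡
              Δ ++ trees (flatten (δ x q y)) ++ trees (map inj₁ rs)
      after = cong (fm collector ∷_) (begin
        trees (flatten (embed ls (δ x q y) rs))
          ≡⟨ cong trees (flatten-embed ls (δ x q y) rs) ⟩
        trees ((map inj₁ ls ʳ++ []) ++ flatten (δ x q y) ++ map inj₁ rs)
          ≡⟨ map-++ _ (map inj₁ ls ʳ++ []) _ ⟩
        trees (map inj₁ ls ʳ++ []) ++ trees (flatten (δ x q y) ++ map inj₁ rs)
          ≡⟨ cong₂ _++_ (map-ʳ++ _ (map inj₁ ls)) (map-++ _ (flatten (δ x q y)) _) ⟩
        (L ʳ++ []) ++ trees (flatten (δ x q y)) ++ trees (map inj₁ rs) ∎)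
        where open ≡-Reasoning
      before : fm collector ∷ trees (flatten ⟨ x ∷ ls ∣ q ∣ y ∷ rs ⟩) ≡
               Δ ++ trees (inj₁ x ∷ inj₂ q ∷ inj₁ y ∷ []) ++ trees (map inj₁ rs)
      before = cong (fm collector ∷_) (trans (map-ʳ++ _ (map inj₁ ls)) (sym (ʳ++-++ L)))

    derivation : ∀ {c} → c ↠ ⟨ [] ∣ final ∣ [] ⟩ → S ⊢ sequent c
    derivation ε =
      -- The whole stoup goes to the premise that proves `retain rules goal`.
      subst (λ ζ → S ⊢ ζ ⨾ fm collector ∷ fm goal ∷ [] ⇒ goal) (++-identityʳ rules)
        (╱L □ {rules} {[]} {Γ = fm goal ∷ []} {[]} {[]} (retain-intro S rules) ax)
    derivation (s ◅ run) = complete-step s (derivation run)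

    -- From derivations back to runs

    data Reduces : List (Cell ⊎ Head) → Set where
      done : Reduces (inj₂ final ∷ [])
      step : ∀ a x q y b → Reduces (a ++ flatten (δ x q y) ++ b) →
             Reduces (a ++ inj₁ x ∷ inj₂ q ∷ inj₁ y ∷ b)

    -- A word with one head can only be rewritten around that head, so rewriting it is running the
    -- machine.
    reduces⇒↠ : ∀ {w} → Reduces w → ∀ c → flatten c ≡ w → c ↠ ⟨ [] ∣ final ∣ [] ⟩
    reduces⇒↠ done ⟨ [] ∣ _ ∣ [] ⟩ refl = ε
    reduces⇒↠ done ⟨ x ∷ ls ∣ _ ∣ _ ⟩ eq = ⊥-elim (ʳ++-≢-singleton (map inj₁ ls) eq)
    reduces⇒↠ (step a x q y b r) ⟨ ls ∣ p ∣ rs ⟩ eq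
      with l₀ , r₀ , refl , refl , refl , refl , refl ← flatten-head-unique ls a eq =
      move ◅ reduces⇒↠ r _ (flatten-embed l₀ (δ x q y) r₀)

    -- The pole consists of arbitrary words, not only of configurations, because a test may add any
    -- letters around a word, further heads included.
    open Semantics name Reduces

    wrap-⟪⟫ : ∀ {u} (S : Calculus u) A → ⟪ wrap S A ⟫ ≡ ⟪ A ⟫
    wrap-⟪⟫ M′₂₀₁₅  A = refl
    wrap-⟪⟫ M′₂₀₁₈  A = refl
    wrap-⟪⟫ M′₂₀₁₈⁻ A = refl

    ⟪var⟫ : ∀ s → ⟪ var {u} (name s) ⟫ ⊆ Closure (_≡ s ∷ [])
    ⟪var⟫ s w∈ a b k = w∈ a b λ { (t , eq , refl) → k (cong (_∷ []) (name-injective t s eq)) }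

    var-sound : ∀ s → ⟪ var {u} (name s) ⟫ (s ∷ [])
    var-sound s = η (s , refl , refl)

    letter-sound : ∀ s → ⟪ letter s ⟫ (s ∷ [])
    letter-sound (inj₁ x) = var-sound (inj₁ x)
    letter-sound (inj₂ q) = subst (λ X → X _) (sym (wrap-⟪⟫ S _)) (var-sound (inj₂ q))

    output-sound : ∀ c → ⟪ output c ⟫ (flatten c)
    output-sound ⟨ l ∣ q ∣ r ⟩ = leftward _ l (rightward _ r (letter-sound (inj₂ q)))
      where
      rightward : ∀ A r {w} → ⟪ A ⟫ w →
                  ⟪ foldl (λ A y → A · letter (inj₁ y)) A r ⟫ (w ++ map inj₁ r)
      rightward A []      {w} w∈ = subst ⟪ A ⟫ (sym (++-identityʳ w)) w∈
      rightward A (y ∷ r) {w} w∈ =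
        subst ⟪ foldl _ _ r ⟫ (++-assoc w _ (map inj₁ r))
          (rightward _ r (η (w , _ , w∈ , letter-sound (inj₁ y) , refl)))
      leftward : ∀ A l {w} → ⟪ A ⟫ w →
                 ⟪ foldl (λ A x → letter (inj₁ x) · A) A l ⟫ (map inj₁ l ʳ++ w)
      leftward A []      w∈ = w∈
      leftward A (x ∷ l) w∈ = leftward _ l (η (_ , _ , letter-sound (inj₁ x) , w∈ , refl))

    -- By closedness the three arguments may be taken to be one-letter words. Any test passed by
    -- `flatten (δ x q y)` is then passed by the word of `x`, `q`, `y`, through one `step`.
    rule-sound : ∀ t → ⟪ rule t ⟫ []
    rule-sound (x , q , y) {w} q∈ {v} y∈ {r} x∈ =
      extend V [] (w ++ v) (λ { refl →
        extend V (inj₁ x ∷ []) v (λ { refl →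
          subst (λ v → ⟪ V ⟫ (inj₁ x ∷ inj₂ q ∷ v)) (++-identityʳ v)
            (extend V (inj₁ x ∷ inj₂ q ∷ []) [] (λ { refl → reduce }) (⟪var⟫ (inj₁ y) y∈)) })
        (⟪var⟫ (inj₂ q) q∈) })
      (⟪var⟫ (inj₁ x) x∈)
      where
      V = output (δ x q y)
      reduce : ⟪ V ⟫ (inj₁ x ∷ inj₂ q ∷ inj₁ y ∷ [])
      reduce = extend-[] V {_≡ flatten (δ x q y)} (λ { refl → output-sound (δ x q y) })
                 λ a b k → step a x q y b (k refl)

    retain-sound : ∀ ζ → ⟪ retain ζ goal ⟫ ⊆ ⟪ goal ⟫
    retain-sound []      w∈ = w∈
    retain-sound (R ∷ ζ) w∈ = extend-[] goal
      (λ { (_ , v , R∈ , v∈ , refl) →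
         extend goal [] v (λ { (refl , _) → retain-sound ζ v∈ }) R∈ }) w∈

    trees-sound : ∀ w → ⟪ trees w ⟫* w
    trees-sound []      = refl
    trees-sound (s ∷ w) = s ∷ [] , w , letter-sound s , trees-sound w , refl

    -- By `retain-sound` the collector contains the empty word, so soundness puts `flatten c` into
    -- `⟪ goal ⟫`.
    halting-run : ∀ {c} → S ⊢ sequent c → c ↠ ⟨ [] ∣ final ∣ [] ⟩
    halting-run {c} d = reduces⇒↠ reduces c refl
      where
      goal∈ : ⟪ goal ⟫ (flatten c)
      goal∈ = sound d
        (map⁺ (universal rule-sound _) , [] , flatten c , retain-sound rules ,
         trees-sound (flatten c) , refl)
      reduces : Reduces (flatten c)
      -- In the empty context, membership in the closure of the final letter is membership in the
      -- pole.
      reduces = subst Reduces (++-identityʳ _)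
        (⟪var⟫ (inj₂ final) (subst (λ X → X _) (wrap-⟪⟫ S _) goal∈) [] [] λ { refl → done })

-- Nonempty lists and finite alphabets

data NonEmpty {A : Set} : List A → Set where
  cons : ∀ {x xs} → NonEmpty (x ∷ xs)

++-nonEmpty : ∀ {A : Set} (xs : List A) {ys} → NonEmpty ys → NonEmpty (xs ++ ys)
++-nonEmpty []      ne = ne
++-nonEmpty (_ ∷ _) _  = cons

ʳ++-nonEmpty : ∀ {A : Set} (xs : List A) {ys} → NonEmpty ys → NonEmpty (xs ʳ++ ys)
ʳ++-nonEmpty []       ne = ne
ʳ++-nonEmpty (_ ∷ xs) _  = ʳ++-nonEmpty xs cons

skip₅ : ∀ {A : Set} {v : A} {a b c d e xs} → v ∈ xs → v ∈ a ∷ b ∷ c ∷ d ∷ e ∷ xs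
skip₅ v∈xs = there (there (there (there (there v∈xs))))

letters : Enumeration Letter
letters .elements =
  `tick ∷ `var ∷ `𝟏 ∷ `╲ ∷ `╱ ∷ `· ∷ `∧ ∷ `∨ ∷ `⟨⟩ ∷ `[]⁻¹ ∷ `! ∷ `[ ∷ `] ∷ `⨾ ∷ `⇒ ∷ []
letters .complete `tick  = here refl
letters .complete `var   = there (here refl)
letters .complete `𝟏     = there (there (here refl))
letters .complete `╲     = there (there (there (here refl)))
letters .complete `╱     = there (there (there (there (here refl))))
letters .complete `·     = skip₅ (here refl)
letters .complete `∧     = skip₅ (there (here refl))
letters .complete `∨     = skip₅ (there (there (here refl)))
letters .complete `⟨⟩    = skip₅ (there (there (there (here refl))))
letters .complete `[]⁻¹  = skip₅ (there (there (there (there (here refl)))))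
letters .complete `!     = skip₅ (skip₅ (here refl))
letters .complete `[     = skip₅ (skip₅ (there (here refl)))
letters .complete `]     = skip₅ (skip₅ (there (there (here refl))))
letters .complete `⨾     = skip₅ (skip₅ (there (there (there (here refl)))))
letters .complete `⇒     = skip₅ (skip₅ (there (there (there (there (here refl))))))

Fin-enumeration : ∀ n → Enumeration (Fin n)
Fin-enumeration n .elements = allFin n
Fin-enumeration n .complete = ∈-allFin

Maybe-enumeration : ∀ {A : Set} → Enumeration A → Enumeration (Maybe A)
Maybe-enumeration as .elements = nothing ∷ map just (elements as)
Maybe-enumeration as .complete nothing  = here refl
Maybe-enumeration as .complete (just a) = there (∈-map⁺ just (complete as a))

retract-enumeration : ∀ {A B : Set} (f : A → B) (g : B → A) → (∀ b → f (g b) ≡ b) →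
                      Enumeration A → Enumeration B
retract-enumeration f g fg as .elements = map f (elements as)
retract-enumeration f g fg as .complete b =
  subst (_∈ map f (elements as)) (fg b) (∈-map⁺ f (complete as (g b)))

-- The self-referential machine

module Diagonal {u : Units} (S : Calculus u) (M : TuringMachine Letter) where

  open TuringMachine M

  -- A pending item is a letter of the text to be copied, or the mark of its end.
  data Cell : Set where
    leftEnd rightEnd : Cell
    plain            : Symbol → Cell
    pending          : Maybe Letter → Cell

  data Head : Set where
    pick rewind resume erase : Head
    carry                    : Maybe Letter → Head
    run                      : State → Head

  cells : Enumeration Cell
  cells = retract-enumeration f g fg
    (⊎-enumeration (Fin-enumeration 2)
      (⊎-enumeration (Maybe-enumeration (⊎-enumeration letters (Fin-enumeration auxiliaries)))
        (Maybe-enumeration letters)))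
    where
    f : Fin 2 ⊎ Symbol ⊎ Maybe Letter → Cell
    f (inj₁ zero)       = leftEnd
    f (inj₁ (suc zero)) = rightEnd
    f (inj₂ (inj₁ x))   = plain x
    f (inj₂ (inj₂ i))   = pending i
    g : Cell → Fin 2 ⊎ Symbol ⊎ Maybe Letter
    g leftEnd     = inj₁ zero
    g rightEnd    = inj₁ (suc zero)
    g (plain x)   = inj₂ (inj₁ x)
    g (pending i) = inj₂ (inj₂ i)
    fg : ∀ b → f (g b) ≡ b
    fg leftEnd     = refl
    fg rightEnd    = refl
    fg (plain _)   = refl
    fg (pending _) = refl

  heads : Enumeration Head
  heads = retract-enumeration f g fg
    (⊎-enumeration (Fin-enumeration 4)
      (⊎-enumeration (Maybe-enumeration letters) (Fin-enumeration states)))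
    where
    f : Fin 4 ⊎ Maybe Letter ⊎ State → Head
    f (inj₁ zero)                   = pick
    f (inj₁ (suc zero))             = rewind
    f (inj₁ (suc (suc zero)))       = resume
    f (inj₁ (suc (suc (suc zero)))) = erase
    f (inj₂ (inj₁ i))               = carry i
    f (inj₂ (inj₂ q))               = run q
    g : Head → Fin 4 ⊎ Maybe Letter ⊎ State
    g pick      = inj₁ zero
    g rewind    = inj₁ (suc zero)
    g resume    = inj₁ (suc (suc zero))
    g erase     = inj₁ (suc (suc (suc zero)))
    g (carry i) = inj₂ (inj₁ i)
    g (run q)   = inj₂ (inj₂ q)
    fg : ∀ b → f (g b) ≡ b
    fg pick      = refl
    fg rewind    = refl
    fg resume    = refl
    fg erase     = refl
    fg (carry _) = refl
    fg (run _)   = refl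

  open Encoding cells heads S

  inputs : List Letter → List Symbol
  inputs = map (λ l → just (inj₁ l))

  text : List Letter → List Cell
  text w = map plain (inputs w)

  -- The end mark contributes everything that follows the pending letters in
  -- the code of the sequent.
  payload : Maybe Letter → List Letter
  payload (just c) = formulaCode (letter (inj₁ (pending (just c))))
  payload nothing  =
    formulaCode (letter (inj₁ (pending nothing))) ++ formulaCode (letter (inj₁ rightEnd)) ++
    `⇒ ∷ formulaCode (letter (inj₂ erase))

  perform : State → Cell → Symbol → Action State Symbol → Config Cell Head
  -- The configuration is reproduced, so the answer `true` becomes an endless loop.
  perform q x         a (halt true)                = ⟨ x ∷ [] ∣ run q ∣ plain a ∷ [] ⟩
  perform q x         a (halt false)               = ⟨ x ∷ [] ∣ erase ∣ plain a ∷ [] ⟩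
  perform q x         a (write b move right to q′) = ⟨ plain b ∷ x ∷ [] ∣ run q′ ∣ [] ⟩
  perform q (plain x) a (write b move left to q′)  = ⟨ [] ∣ run q′ ∣ plain x ∷ plain b ∷ [] ⟩
  -- At the left end of the tape a blank cell is created next to the mark.
  perform q x         a (write b move left to q′)  = ⟨ x ∷ [] ∣ run q′ ∣ plain nothing ∷ plain b ∷ [] ⟩

  -- Each pending letter is turned into a plain one and its payload is
  -- appended at the right end; then M is run on the resulting word.
  δ : Cell → Head → Cell → Config Cell Head
  δ x           pick      (pending i) = ⟨ text (fromMaybe i) ʳ++ x ∷ [] ∣ carry i ∣ [] ⟩
  δ x           (carry i) rightEnd    = ⟨ x ∷ [] ∣ rewind ∣ text (payload i) ++ rightEnd ∷ [] ⟩
  δ x           (carry i) y           = ⟨ y ∷ x ∷ [] ∣ carry i ∣ [] ⟩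
  δ (plain a)   rewind    y           = ⟨ [] ∣ rewind ∣ plain a ∷ y ∷ [] ⟩
  δ (pending i) rewind    y           = ⟨ [] ∣ resume ∣ pending i ∷ y ∷ [] ⟩
  δ leftEnd     rewind    y           = ⟨ leftEnd ∷ [] ∣ run start ∣ y ∷ [] ⟩
  δ (pending i) resume    y           = ⟨ [] ∣ resume ∣ pending i ∷ y ∷ [] ⟩
  δ x           resume    y           = ⟨ x ∷ [] ∣ pick ∣ y ∷ [] ⟩
  δ x           (run q)   (plain a)   = perform q x a (transition q a)
  δ x           (run q)   y           = ⟨ x ∷ [] ∣ run q ∣ plain nothing ∷ y ∷ [] ⟩
  δ (plain _)   erase     y           = ⟨ [] ∣ erase ∣ y ∷ [] ⟩
  δ leftEnd     erase     (plain _)   = ⟨ leftEnd ∷ [] ∣ erase ∣ [] ⟩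
  δ leftEnd     erase     rightEnd    = ⟨ [] ∣ erase ∣ [] ⟩
  δ x           q         y           = ⟨ x ∷ [] ∣ q ∣ y ∷ [] ⟩

  open Machine δ
  open Reduction δ erase

  -- The code of the sequent up to its first pending cell. It depends on the machine but not on the
  -- initial configuration, so storing it in the pending cells is not circular.
  prefix : List Letter
  prefix = stoupCode rules ++ `⨾ ∷ formulaCode collector ++
           formulaCode (letter (inj₁ leftEnd)) ++ formulaCode (letter (inj₂ pick))

  items : List (Maybe Letter)
  items = map just prefix ++ nothing ∷ []

  initialConfig : Config Cell Head
  initialConfig = ⟨ leftEnd ∷ [] ∣ pick ∣ map pending items ++ rightEnd ∷ [] ⟩

  quine : Sequent u multiplicative
  quine = sequent initialConfig

  kept : ∀ (w : List Letter) → concatMap fromMaybe (map just w ++ nothing ∷ []) ≡ w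
  kept []      = refl
  kept (c ∷ w) = cong (c ∷_) (kept w)

  treesCode-items : ∀ w →
    treesCode (trees (map inj₁ (map pending (map just w ++ nothing ∷ []) ++ rightEnd ∷ []))) ++
      `⇒ ∷ formulaCode goal ≡
    concatMap payload (map just w ++ nothing ∷ [])
  treesCode-items (c ∷ w) = trans (++-assoc (payload (just c)) _ _)
                                  (cong (payload (just c) ++_) (treesCode-items w))
  treesCode-items [] = begin
    (p ++ r ++ []) ++ g ≡⟨ ++-assoc p (r ++ []) g ⟩
    p ++ (r ++ []) ++ g ≡⟨ cong (λ r → p ++ r ++ g) (++-identityʳ r) ⟩
    p ++ r ++ g         ≡⟨ ++-identityʳ _ ⟨
    (p ++ r ++ g) ++ [] ∎
    where
    open ≡-Reasoning
    p = formulaCode (letter (inj₁ (pending nothing)))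
    r = formulaCode (letter (inj₁ rightEnd))
    g = `⇒ ∷ formulaCode goal

  -- The stored letters are used twice: as they stand they give the code up to the pending cells,
  -- and through `payload`, with the end mark, the code of those cells and of all that follows.
  quine-code : concatMap fromMaybe items ++ concatMap payload items ≡ sequentCode quine
  quine-code = begin
    concatMap fromMaybe items ++ concatMap payload items
      ≡⟨ cong₂ _++_ (kept prefix) (sym (treesCode-items prefix)) ⟩
    (s ++ `⨾ ∷ k ++ l ++ p) ++ t ++ g    ≡⟨ ++-assoc s _ _ ⟩
    s ++ `⨾ ∷ (k ++ l ++ p) ++ t ++ g    ≡⟨ cong (λ w → s ++ `⨾ ∷ w) (++-assoc k (l ++ p) (t ++ g)) ⟩
    s ++ `⨾ ∷ k ++ (l ++ p) ++ t ++ g    ≡⟨ cong (λ w → s ++ `⨾ ∷ k ++ w) (++-assoc l p (t ++ g)) ⟩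
    s ++ `⨾ ∷ k ++ l ++ p ++ t ++ g      ≡⟨ cong (λ w → s ++ `⨾ ∷ k ++ l ++ w) (++-assoc p t g) ⟨
    s ++ `⨾ ∷ k ++ l ++ (p ++ t) ++ g    ≡⟨ cong (λ w → s ++ `⨾ ∷ k ++ w) (++-assoc l (p ++ t) g) ⟨
    s ++ `⨾ ∷ k ++ (l ++ p ++ t) ++ g    ≡⟨ cong (λ w → s ++ `⨾ ∷ w) (++-assoc k (l ++ p ++ t) g) ⟨
    s ++ `⨾ ∷ (k ++ l ++ p ++ t) ++ g    ≡⟨ ++-assoc s (`⨾ ∷ k ++ l ++ p ++ t) g ⟨
    (s ++ `⨾ ∷ k ++ l ++ p ++ t) ++ g    ∎
    where
    open ≡-Reasoning
    s = stoupCode rules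
    k = formulaCode collector
    l = formulaCode (letter (inj₁ leftEnd))
    p = formulaCode (letter (inj₂ pick))
    t = treesCode (trees (map inj₁ (map pending items ++ rightEnd ∷ [])))
    g = `⇒ ∷ formulaCode goal

  -- The copying phase

  data Settled : List Cell → Set where
    end    : ∀ {ls} → Settled (leftEnd ∷ ls)
    symbol : ∀ {a ls} → Settled (plain a ∷ ls)

  settled-text : ∀ w {ls} → Settled ls → Settled (text w ʳ++ ls)
  settled-text []      s = s
  settled-text (_ ∷ w) _ = settled-text w symbol

  -- A step needs a cell on each side of the head, hence the hypotheses `NonEmpty` here and below.
  pick-step : ∀ {ls} i {rs} → NonEmpty ls →
              ⟨ ls ∣ pick ∣ pending i ∷ rs ⟩ ↠ ⟨ text (fromMaybe i) ʳ++ ls ∣ carry i ∣ rs ⟩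
  pick-step nothing  cons = move ◅ ε
  pick-step (just _) cons = move ◅ ε

  carry-pending : ∀ {i ls} is {rs} → NonEmpty ls →
    ⟨ ls ∣ carry i ∣ map pending is ++ rs ⟩ ↠ ⟨ map pending is ʳ++ ls ∣ carry i ∣ rs ⟩
  carry-pending []       cons = ε
  carry-pending (_ ∷ is) cons = move ◅ carry-pending is cons

  carry-plain : ∀ {i ls} as {rs} → NonEmpty ls →
    ⟨ ls ∣ carry i ∣ map plain as ++ rs ⟩ ↠ ⟨ map plain as ʳ++ ls ∣ carry i ∣ rs ⟩
  carry-plain []       cons = ε
  carry-plain (_ ∷ as) cons = move ◅ carry-plain as cons

  deposit : ∀ {i ls} → NonEmpty ls →
    ⟨ ls ∣ carry i ∣ rightEnd ∷ [] ⟩ ↠ ⟨ ls ∣ rewind ∣ text (payload i) ++ rightEnd ∷ [] ⟩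
  deposit {i} {_ ∷ ls} cons =
    subst (λ rs → _ ↠ ⟨ _ ∣ rewind ∣ rs ⟩) (++-identityʳ _) (move ◅ ε)

  rewind-plain : ∀ as {ls rs} → NonEmpty rs →
    ⟨ map plain as ʳ++ ls ∣ rewind ∣ rs ⟩ ↠ ⟨ ls ∣ rewind ∣ map plain as ++ rs ⟩
  rewind-plain []       _  = ε
  rewind-plain (a ∷ as) {ls} {rs} ne = rewind-plain as ne ◅◅ last (++-nonEmpty (map plain as) ne)
    where
    last : ∀ {rs} → NonEmpty rs → ⟨ plain a ∷ ls ∣ rewind ∣ rs ⟩ ↠ ⟨ ls ∣ rewind ∣ plain a ∷ rs ⟩
    last cons = move ◅ ε

  rewind-pending : ∀ i is {ls rs} → NonEmpty rs →
    ⟨ map pending (i ∷ is) ʳ++ ls ∣ rewind ∣ rs ⟩ ↠ ⟨ ls ∣ resume ∣ map pending (i ∷ is) ++ rs ⟩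
  rewind-pending i []       cons = move ◅ ε
  rewind-pending i (j ∷ is) ne   = rewind-pending j is ne ◅◅ (move ◅ ε)

  resume-step : ∀ {ls rs} → Settled ls → NonEmpty rs →
                ⟨ ls ∣ resume ∣ rs ⟩ ↠ ⟨ ls ∣ pick ∣ rs ⟩
  resume-step end    cons = move ◅ ε
  resume-step symbol cons = move ◅ ε

  text-++ : ∀ v w rs → text v ++ text w ++ rs ≡ text (v ++ w) ++ rs
  text-++ v w rs = begin
    text v ++ text w ++ rs   ≡⟨ ++-assoc (text v) (text w) rs ⟨
    (text v ++ text w) ++ rs ≡⟨ cong (_++ rs) (map-++ plain (inputs v) (inputs w)) ⟨
    map plain (inputs v ++ inputs w) ++ rs ≡⟨ cong (λ w → map plain w ++ rs) (map-++ _ v w) ⟨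
    text (v ++ w) ++ rs ∎
    where open ≡-Reasoning

  text-ʳ++ : ∀ v w {ls} → text w ʳ++ text v ʳ++ ls ≡ text (v ++ w) ʳ++ ls
  text-ʳ++ []      w = refl
  text-ʳ++ (_ ∷ v) w = text-ʳ++ v w

  -- One trip to the right end and back to the remaining pending cells; `v` is the text read so far,
  -- `w` the payloads written so far.
  copy-item : ∀ i is v w →
    ⟨ text v ʳ++ leftEnd ∷ [] ∣ pick ∣ map pending (i ∷ is) ++ text w ++ rightEnd ∷ [] ⟩ ↠
    ⟨ map pending is ʳ++ text (v ++ fromMaybe i) ʳ++ leftEnd ∷ [] ∣ rewind ∣
      text (w ++ payload i) ++ rightEnd ∷ [] ⟩
  copy-item i is v w =
    subst₂ (λ ls rs → ⟨ L ∣ pick ∣ R ⟩ ↠ ⟨ map pending is ʳ++ ls ∣ rewind ∣ rs ⟩)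
      (text-ʳ++ v (fromMaybe i)) (text-++ w (payload i) (rightEnd ∷ []))
      (pick-step i ne₁ ◅◅ carry-pending is ne₂ ◅◅ carry-plain (inputs w) ne₃ ◅◅
       deposit (ʳ++-nonEmpty (text w) ne₃) ◅◅
       rewind-plain (inputs w) (++-nonEmpty (text (payload i)) cons))
    where
    L = text v ʳ++ leftEnd ∷ []
    R = map pending (i ∷ is) ++ text w ++ rightEnd ∷ []
    ne₁ = ʳ++-nonEmpty (text v) cons
    ne₂ = ʳ++-nonEmpty (text (fromMaybe i)) ne₁
    ne₃ = ʳ++-nonEmpty (map pending is) ne₂

  -- The way back shows whether items remain: a pending cell turns `rewind` into `resume`, which
  -- leads to the next `pick`; without one, `rewind` reaches the left end and starts `M` on a word
  -- of plain cells.
  copy : ∀ i is v w →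
    ⟨ text v ʳ++ leftEnd ∷ [] ∣ pick ∣ map pending (i ∷ is) ++ text w ++ rightEnd ∷ [] ⟩ ↠
    ⟨ leftEnd ∷ [] ∣ run start ∣
      text ((v ++ concatMap fromMaybe (i ∷ is)) ++ w ++ concatMap payload (i ∷ is)) ++
      rightEnd ∷ [] ⟩
  copy i [] v w =
    subst (λ rs → ⟨ L ∣ pick ∣ R ⟩ ↠ ⟨ leftEnd ∷ [] ∣ run start ∣ rs ⟩) eq
    (copy-item i [] v w ◅◅
     rewind-plain (inputs (v ++ fromMaybe i)) (++-nonEmpty (text (w ++ payload i)) cons) ◅◅
     last (++-nonEmpty (text (v ++ fromMaybe i)) (++-nonEmpty (text (w ++ payload i)) cons)))
    where
    L = text v ʳ++ leftEnd ∷ []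
    R = pending i ∷ text w ++ rightEnd ∷ []
    last : ∀ {rs} → NonEmpty rs →
           ⟨ leftEnd ∷ [] ∣ rewind ∣ rs ⟩ ↠ ⟨ leftEnd ∷ [] ∣ run start ∣ rs ⟩
    last cons = move ◅ ε
    eq : text (v ++ fromMaybe i) ++ text (w ++ payload i) ++ rightEnd ∷ [] ≡
         text ((v ++ fromMaybe i ++ []) ++ w ++ payload i ++ []) ++ rightEnd ∷ []
    eq = trans (text-++ (v ++ fromMaybe i) (w ++ payload i) (rightEnd ∷ []))
           (cong₂ (λ v′ w′ → text ((v ++ v′) ++ w ++ w′) ++ rightEnd ∷ [])
             (sym (++-identityʳ (fromMaybe i))) (sym (++-identityʳ (payload i))))
  copy i (j ∷ is) v w =
    subst (λ w → ⟨ L ∣ pick ∣ R ⟩ ↠ ⟨ leftEnd ∷ [] ∣ run start ∣ text w ++ rightEnd ∷ [] ⟩)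
      (cong₂ _++_ (++-assoc v (fromMaybe i) _) (++-assoc w (payload i) _))
      (copy-item i (j ∷ is) v w ◅◅
       rewind-pending j is ne ◅◅
       resume-step (settled-text (v ++ fromMaybe i) end) cons ◅◅
       copy j is (v ++ fromMaybe i) (w ++ payload i))
    where
    L = text v ʳ++ leftEnd ∷ []
    R = map pending (i ∷ j ∷ is) ++ text w ++ rightEnd ∷ []
    ne = ++-nonEmpty (text (w ++ payload i)) cons

  copy-all : ∀ w → let is = map just w ++ nothing ∷ [] in
    ⟨ leftEnd ∷ [] ∣ pick ∣ map pending is ++ rightEnd ∷ [] ⟩ ↠
    ⟨ leftEnd ∷ [] ∣ run start ∣
      text (concatMap fromMaybe is ++ concatMap payload is) ++ rightEnd ∷ [] ⟩
  copy-all []      = copy nothing [] [] []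
  copy-all (c ∷ w) = copy (just c) (map just w ++ nothing ∷ []) [] []

  -- Simulation of the decider

  simulating : State → Tape Symbol → Config Cell Head
  simulating q (tape ls a rs) =
    ⟨ map plain ls ++ leftEnd ∷ [] ∣ run q ∣ plain a ∷ map plain rs ++ rightEnd ∷ [] ⟩

  load : ∀ w → ⟨ leftEnd ∷ [] ∣ run start ∣ text w ++ rightEnd ∷ [] ⟩ ↠
               simulating start (initial (inputs w))
  -- For the empty word the scanned cell is a blank inserted before `rightEnd`.
  load []      = move ◅ ε
  load (_ ∷ _) = ε

  -- The answers are crossed: `true` must prevent termination, witnessed by a reachable
  -- configuration that steps to itself, and `false` must bring about the final configuration.
  Outcome : Bool → Config Cell Head → Set
  Outcome true  c = ∃[ d ] (c ↠ d) × (d ⟶ d)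
  Outcome false c = c ↠ ⟨ [] ∣ erase ∣ [] ⟩

  outcome-back : ∀ b {c d} → c ↠ d → Outcome b d → Outcome b c
  outcome-back true  r (e , r′ , loop) = e , r ◅◅ r′ , loop
  outcome-back false r r′              = r ◅◅ r′

  run-step : ∀ {q x ls a rs action} → transition q a ≡ action →
             ⟨ x ∷ ls ∣ run q ∣ plain a ∷ rs ⟩ ⟶ embed ls (perform q x a action) rs
  run-step refl = move

  erase-right : ∀ as → ⟨ leftEnd ∷ [] ∣ erase ∣ map plain as ++ rightEnd ∷ [] ⟩ ↠ ⟨ [] ∣ erase ∣ [] ⟩
  erase-right []       = move ◅ ε
  erase-right (_ ∷ as) = move ◅ erase-right as

  -- Cells to the left go first; from the left end the head then deletes rightwards, until both end
  -- marks vanish together.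
  erase-all : ∀ as {rs} bs → rs ≡ map plain bs ++ rightEnd ∷ [] → NonEmpty rs →
              ⟨ map plain as ++ leftEnd ∷ [] ∣ erase ∣ rs ⟩ ↠ ⟨ [] ∣ erase ∣ [] ⟩
  erase-all []       bs refl _    = erase-right bs
  erase-all (_ ∷ as) bs eq   cons = move ◅ erase-all as bs eq cons

  simulate : ∀ {q t b} → Run M q t b → Outcome b (simulating q t)
  simulate {t = tape []      a rs} {true}  (halts eq) = _ , ε , run-step eq
  simulate {t = tape (_ ∷ _) a rs} {true}  (halts eq) = _ , ε , run-step eq
  simulate {t = tape []       a rs} {false} (halts eq) = run-step eq ◅ erase-all [] (a ∷ rs) refl cons
  simulate {t = tape (l ∷ ls) a rs} {false} (halts eq) =
    run-step eq ◅ erase-all (l ∷ ls) (a ∷ rs) refl cons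
  simulate {t = tape ls a rs} {b} (steps {m = m} eq r) =
    outcome-back b (tape-step m ls rs eq) (simulate r)
    where
    tape-step : ∀ {q a b q′} m ls rs → transition q a ≡ write b move m to q′ →
                simulating q (tape ls a rs) ↠ simulating q′ (Defs.shift m (tape ls b rs))
    tape-step left  []       rs       eq = run-step eq ◅ ε
    tape-step left  (_ ∷ ls) rs       eq = run-step eq ◅ ε
    -- Past the last cell the head faces `rightEnd`, and a second step inserts the blank to be
    -- scanned.
    tape-step right []       []       eq = run-step eq ◅ move ◅ ε
    tape-step right []       (_ ∷ _)  eq = run-step eq ◅ ε
    tape-step right (_ ∷ _)  []       eq = run-step eq ◅ move ◅ ε
    tape-step right (_ ∷ _)  (_ ∷ _)  eq = run-step eq ◅ ε

  answer-outcome : ∀ w {b} → Answers M w b →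
                   Outcome b ⟨ leftEnd ∷ [] ∣ run start ∣ text w ++ rightEnd ∷ [] ⟩
  answer-outcome w {b} r = outcome-back b (load w) (simulate r)

  outcome : ∀ {b} → Answers M (sequentCode quine) b → Outcome b initialConfig
  outcome {b} r = outcome-back b (copy-all prefix)
    (subst (λ w → Outcome b ⟨ leftEnd ∷ [] ∣ run start ∣ text w ++ rightEnd ∷ [] ⟩)
      (sym quine-code) (answer-outcome (sequentCode quine) r))

  -- The contradiction

  looping : ∀ {c} → Outcome true c → ¬ Outcome false c
  looping (_ , r , loop) r′ = ↠-loop loop (↠-confluent r r′)

  answers : Decides M (code {u} {multiplicative}) (S ⊢_) → ∀ s →
            (S ⊢ s → Answers M (sequentCode s) true) × (¬ (S ⊢ s) → Answers M (sequentCode s) false)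
  answers decides s = decides s

  -- Underivability of `quine` is proved first: a derivation would yield both a terminating run and
  -- the answer `true`, hence a loop. The answer is then `false`, and the resulting run to the final
  -- configuration is a derivation after all.
  ¬decides : ¬ Decides M (code {u} {multiplicative}) (S ⊢_)
  ¬decides decides = underivable (derivation {initialConfig}
      (outcome {false} (proj₂ (answers decides quine) underivable)))
    where
    underivable : ¬ (S ⊢ quine)
    underivable d =
      looping (outcome {true} (proj₁ (answers decides quine) d)) (halting-run {initialConfig} d)

undecidable : ∀ {u} (S : Calculus u) → DerivabilityUndecidable S multiplicative
undecidable S (M , decides) = Diagonal.¬decides S M decides

theorem7 : DerivabilityUndecidable M′₂₀₁₅ multiplicative ×
    DerivabilityUndecidable M′₂₀₁₈ multiplicative ×
    DerivabilityUndecidable M′₂₀₁₈⁻ multiplicative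
theorem7 = undecidable M′₂₀₁₅ , undecidable M′₂₀₁₈ , undecidable M′₂₀₁₈⁻
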